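{- The deterministic algorithm HeavyTest for online graph exploration on cycles has competitive ratio $\frac{\sqrt{3}+1}{2}\approx 1.366$.
   Context: **Online exploration of cycles.** The input is a cycle $\Gamma$ (a cycle graph on $n\ge 3$ vertices) with non-negative edge weights $w$, together with a starting vertex $s$. An agent starts at $s$ and initially has no knowledge of the graph other than that it is a cycle. Whenever it visits a vertex for the first time (including $s$ at the start), it learns the identifiers of the adjacent vertices and the weights of the incident edges. The agent repeatedly decides which known edge to traverse next; traversing an edge costs its weight. The agent must visit all vertices and return to $s$. Let $\mathrm{Alg}(\Gamma,s)$ be the total cost of a deterministic algorithm $\mathrm{Alg}$, and let $\mathrm{Opt}(\Gamma)$ be the minimum length of a closed walk in $\Gamma$ visiting every vertex. $\mathrm{Alg}$ is $\rho$-competitive (on cycles) if $\mathrm{Alg}(\Gamma,s)\le \rho\cdot \mathrm{Opt}(\Gamma)$ for every weighted cycle $\Gamma$ and every starting vertex $s$. The competitive ratio of $\mathrm{Alg}$ is the infimum of all such $\rho$. **Exploration steps.** A boundary edge is an edge with one explored (i.e. visited) and one unexplored endpoint. In each step the agent chooses a boundary edge, travels through the explored part (a path) to its explored endpoint, and traverses it. The explored part is a path until everything is visited, so there are exactly two boundary edges, one at each end; after each step the agent is at the explored endpoint of one of them, called the direct boundary edge; the other one is called the backtracking boundary edge. The agent "moves directly" if it chooses the direct boundary edge and "backtracks" otherwise. While the agent is at $v$ after at least one step and not all vertices are visited, let $b$ be the weight of the direct boundary edge, let $a$ be the length of the explored path from $v$ to $s$, and let $d$ be the length of the path from $s$, through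 the explored part on the other side, to the unexplored endpoint of the backtracking boundary edge (including that edge's weight). Thus a direct move costs $b$ and backtracking costs $a+d$. (If the two boundary edges share their unexplored endpoint, the algorithm does not use this information.) **HeavyTest.** The first edge traversed is the lighter of the two edges incident to $s$ (ties broken arbitrarily but deterministically). From the second step until all vertices are visited, the agent moves directly if and only if $b\le \sqrt{3}\,a+d$. Once the last vertex has been visited, the agent returns to $s$ via a shortest path. -}

module Defs where

open import Level using (Level; suc)
open import Algebra.Bundles using (CommutativeRing)
open import Data.Bool using (Bool; if_then_else_)
open import Data.Fin using (Fin; toℕ)
open import Data.List using (List; []; _∷_; _++_; replicate)
open import Data.List.Membership.Propositional using (_∈_)
open import Data.Nat as ℕ using (ℕ)
open import Data.Nat.DivMod using (_mod_)
open import Data.Product using (∃; ∃₂; _×_)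
open import Function.Definitions using (Injective)
open import Relation.Binary.Core using (Rel)
open import Relation.Binary.PropositionalEquality using (_≡_)
open import Relation.Binary.Structures using (IsDecTotalOrder)
open import Relation.Nullary using (¬_)
open import Relation.Nullary.Decidable using (does)
open import Relation.Unary using (Pred)

module Bounds {ℓ : Level} {A : Set ℓ} (_≤_ : Rel A ℓ) where

  IsUpperBound IsLowerBound IsSupremum IsInfimum : Pred A ℓ → A → Set ℓ
  IsUpperBound P u = ∀ x → P x → x ≤ u
  IsLowerBound P l = ∀ x → P x → l ≤ x
  IsSupremum   P s = IsUpperBound P s × (∀ u → IsUpperBound P u → s ≤ u)
  IsInfimum    P i = IsLowerBound P i × (∀ l → IsLowerBound P l → l ≤ i)

-- The real numbers, as a Dedekind-complete ordered field.  The order is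
-- decidable, as it is for the classical reals, so that an algorithm can branch
-- on comparisons.

record RealField (ℓ : Level) : Set (suc ℓ) where
  field
    commutativeRing : CommutativeRing ℓ ℓ

  open CommutativeRing commutativeRing public
    using (Carrier; _≈_; _+_; _*_; -_; 0#; 1#)

  infix 4 _≤_
  infix 8 _⁻¹

  field
    _≤_             : Rel Carrier ℓ
    isDecTotalOrder : IsDecTotalOrder _≈_ _≤_
    +-monoˡ-≤       : ∀ z {x y} → x ≤ y → x + z ≤ y + z
    *-nonNeg        : ∀ {x y} → 0# ≤ x → 0# ≤ y → 0# ≤ x * y
    0≉1             : ¬ 0# ≈ 1#
    -- The value of 0# ⁻¹ is left unspecified.
    _⁻¹             : Carrier → Carrier
    ⁻¹-inverse      : ∀ x → ¬ x ≈ 0# → x * x ⁻¹ ≈ 1#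

  open IsDecTotalOrder isDecTotalOrder public using (_≟_; _≤?_)

  open Bounds _≤_ public

  field
    complete : (P : Pred Carrier ℓ) → ∃ P → ∃ (IsUpperBound P) → ∃ (IsSupremum P)

data Dir : Set where
  cw ccw : Dir

opposite : Dir → Dir
opposite cw  = ccw
opposite ccw = cw

module Exploration {ℓ : Level} (R : RealField ℓ) where

  open RealField R

  -- A weighted cycle on n = 3 + extra vertices, listed in cyclic order.  The
  -- identifiers that the agent sees are arbitrary distinct numbers, so they
  -- carry no information about the positions on the cycle.

  record Cycle : Set ℓ where
    field
      extra : ℕ

    n : ℕ
    n = 3 ℕ.+ extra

    Vertex : Set
    Vertex = Fin n

    field
      identifier           : Vertex → ℕ
      identifier-injective : Injective _≡_ _≡_ identifier
      -- The weight of the edge between v and its clockwise neighbour, move cw v.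
      weight               : Vertex → Carrier
      weight-nonNeg        : ∀ v → 0# ≤ weight v

    move : Dir → Vertex → Vertex
    move cw  v = ℕ.suc (toℕ v) mod n
    move ccw v = (toℕ v ℕ.+ (2 ℕ.+ extra)) mod n

    edgeWeight : Dir → Vertex → Carrier
    edgeWeight cw  v = weight v
    edgeWeight ccw v = weight (move ccw v)

    -- A walk is a start vertex together with a list of directions.

    endpoint : Vertex → List Dir → Vertex
    endpoint v []      = v
    endpoint v (δ ∷ p) = endpoint (move δ v) p

    visited : Vertex → List Dir → List Vertex
    visited v []      = v ∷ []
    visited v (δ ∷ p) = v ∷ visited (move δ v) p

    cost : Vertex → List Dir → Carrier
    cost v []      = 0#
    cost v (δ ∷ p) = edgeWeight δ v + cost (move δ v) p

    IsTour : Vertex → List Dir → Set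
    IsTour v p = endpoint v p ≡ v × (∀ u → u ∈ visited v p)

    IsOpt : Carrier → Set ℓ
    IsOpt o = (∃₂ λ v p → IsTour v p × cost v p ≈ o)
            × (∀ v p → IsTour v p → o ≤ cost v p)

  CostFunction : Set ℓ
  CostFunction = (Γ : Cycle) → Cycle.Vertex Γ → Carrier

  Competitive : CostFunction → Pred Carrier ℓ
  Competitive alg ρ =
    ∀ (Γ : Cycle) (s : Cycle.Vertex Γ) → ∃ λ o → Cycle.IsOpt Γ o × alg Γ s ≤ ρ * o

  IsCompetitiveRatio : CostFunction → Carrier → Set ℓ
  IsCompetitiveRatio alg = IsInfimum (Competitive alg)

  -- Resolves a tie at the start from everything the agent then knows: the
  -- identifiers of the start vertex, of its clockwise and of its
  -- counterclockwise neighbour, and the common weight of the incident edges.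

  TieBreak : Set ℓ
  TieBreak = ℕ → ℕ → ℕ → Carrier → Dir

  module HeavyTest (√3 : Carrier) (tie : TieBreak) (Γ : Cycle) (s : Cycle.Vertex Γ) where

    open Cycle Γ

    firstDir : Dir
    firstDir =
      if does (edgeWeight cw s ≟ edgeWeight ccw s)
      then tie (identifier s) (identifier (move cw s)) (identifier (move ccw s))
               (edgeWeight cw s)
      else if does (edgeWeight cw s ≤? edgeWeight ccw s) then cw else ccw

    -- In the states below, the explored vertices are s, the i vertices next to
    -- s in direction δ and the j vertices next to s in the other direction, and
    -- the agent is at the end of the explored path in direction δ.

    position : Dir → ℕ → Vertex
    position δ i = endpoint s (replicate i δ)

    backToStart : Dir → ℕ → List Dir
    backToStart δ i = replicate i (opposite δ)

    movesDirectly : Dir → ℕ → ℕ → Bool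
    movesDirectly δ i j = does (b ≤? √3 * a + d)
      where
      b = edgeWeight δ (position δ i)
      a = cost (position δ i) (backToStart δ i)
      d = cost s (replicate (ℕ.suc j) (opposite δ))

    -- With all vertices visited, i + j + 1 = n, so going on in direction δ
    -- reaches s after suc j edges.
    return : Dir → ℕ → ℕ → List Dir
    return δ i j =
      if does (cost v (backToStart δ i) ≤? cost v onward) then backToStart δ i else onward
      where
      v      = position δ i
      onward = replicate (ℕ.suc j) δ

    -- The first argument is the number of unexplored vertices.
    explore : ℕ → Dir → ℕ → ℕ → List Dir
    explore ℕ.zero    δ i j = return δ i j
    explore (ℕ.suc k) δ i j =
      if movesDirectly δ i j
      then δ ∷ explore k δ (ℕ.suc i) j
      else backToStart δ i ++ replicate (ℕ.suc j) (opposite δ)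
             ++ explore k (opposite δ) (ℕ.suc j) i

    tour : List Dir
    tour = firstDir ∷ explore (1 ℕ.+ extra) firstDir 1 0

  heavyTest : Carrier → TieBreak → CostFunction
  heavyTest √3 tie Γ s = Cycle.cost Γ s (HeavyTest.tour √3 tie Γ s)

{-# OPTIONS --safe #-}
module Submission where

open import Algebra.Bundles using (CommutativeRing)
open import Data.Bool using (true; false; if_then_else_)
open import Data.Fin using (Fin; toℕ)
open import Data.Fin.Properties using (toℕ-fromℕ<; toℕ-injective; toℕ<n; all?; ¬∀⟶∃¬)
  renaming (_≟_ to _≟ᶠ_)
open import Data.List using (List; []; _∷_; _++_; [_]; replicate; applyUpTo; allFin)
import Data.List.Extrema as Extrema
import Data.List.Membership.DecPropositional as DecMembership
open import Data.List.Membership.Propositional using (_∈_; _∉_)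
open import Data.List.Membership.Propositional.Properties
  using (∈-∃++; ∈-++⁺ˡ; ∈-++⁺ʳ; ∈-++⁻; ∈-allFin)
open import Data.List.Properties using (++-assoc)
open import Data.List.Relation.Binary.Permutation.Propositional as ↭ using (_↭_)
import Data.List.Relation.Binary.Permutation.Propositional.Properties as ↭ₚ
open import Data.List.Relation.Binary.Subset.Propositional using (_⊆_)
open import Data.List.Relation.Unary.All as All using (All)
open import Data.List.Relation.Unary.AllPairs using (_∷_)
open import Data.List.Relation.Unary.Any using (here; there)
open import Data.List.Relation.Unary.Unique.Propositional using (Unique)
import Data.List.Relation.Unary.Unique.Propositional.Properties as Uniqueₚ
open import Data.Nat as ℕ using (ℕ; zero; suc; _∸_; _%_; z≤n; s≤s)
open import Data.Nat.DivMod
  using (m<n⇒m%n≡m; m%n<n; [m+n]%n≡m%n; m%n%n≡m%n; %-distribˡ-+)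
import Data.Nat.Properties as ℕₚ
open import Data.Product using (∃; ∃₂; _×_; _,_; proj₁; proj₂)
open import Data.Sum using (_⊎_; inj₁; inj₂)
open import Relation.Binary.Bundles using (TotalOrder)
open import Relation.Binary.PropositionalEquality as ≡ using (_≡_; _≢_; cong; subst)
import Relation.Binary.Reasoning.Setoid as ≈-Reasoning
open import Relation.Binary.Structures using (IsDecTotalOrder)
open import Relation.Nullary using (¬_; Dec; yes; no; contradiction)
open import Relation.Nullary.Decidable using (does; dec-true; dec-false)
open import Defs

-- Upper bound.  Write W for the length of the cycle.  A tour either traverses every
-- edge or, avoiding some edge e, traverses all others twice; so Opt is the minimum
-- of W and of 2(W - e) over all edges e.  When the agent backtracks at distance a
-- from s from an edge of weight b > √3 a + d, the excess cost is 2a, and the length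
-- of the other side grows from d to a + b, which exceeds (√3 + 1) a + d.  Hence the
-- total excess stays below (√3 - 1) d, where d is the length of the other side
-- together with its boundary edge.  At the end W = a + d, so the cost, the excess
-- plus a + min(a, d), is at most (√3 + 1)/2 W.  For the bound by 2(W - e) it is
-- enough that each edge e is at most as heavy as the last untraversed edge or
-- satisfies (√3 + 1) e ≤ √3 a + d, which every step of the agent preserves.
--
-- Lower bound.  After many light edges the agent just refuses an edge of weight b,
-- and the remaining edges make it finish at the point opposite to s.

-- Arithmetic of ordered fields and sums over lists.

module OrderedField {ℓ} (R : RealField ℓ) where

  open RealField R
  open CommutativeRing commutativeRing public
    using (+-cong; +-comm; +-assoc; *-comm; +-identityˡ; +-identityʳ;
           *-identityˡ; distribˡ; distribʳ; zeroʳ; -‿inverseˡ; -‿inverseʳ;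
           +-congˡ; +-congʳ; -‿cong; *-congˡ; *-congʳ;
           setoid; commutativeSemiring; semiring; ring)
    renaming (refl to ≈-refl; sym to ≈-sym; trans to ≈-trans; reflexive to ≈-reflexive)
  open IsDecTotalOrder isDecTotalOrder public
    using (total; antisym; ≤-respˡ-≈; ≤-respʳ-≈)
    renaming (refl to ≤-refl; trans to ≤-trans; reflexive to ≤-reflexive)
  open import Algebra.Solver.Ring.NaturalCoefficients.Default commutativeSemiring public
    using (solve; _:=_; _:+_; _:*_; con)
  open import Algebra.Properties.Ring ring using (-‿distribˡ-*; -‿involutive)
  open import Algebra.Properties.Semiring.Mult semiring public
    using () renaming (_×_ to _·_)

  +-mono-≤ : ∀ {w x y z} → w ≤ x → y ≤ z → w + y ≤ x + z
  +-mono-≤ {w} {x} {y} {z} w≤x y≤z = ≤-trans (+-monoˡ-≤ y w≤x)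
    (≤-respˡ-≈ (+-comm y x) (≤-respʳ-≈ (+-comm z x) (+-monoˡ-≤ x y≤z)))

  +-cancelʳ-≤ : ∀ z {x y} → x + z ≤ y + z → x ≤ y
  +-cancelʳ-≤ z {x} {y} h = ≤-respˡ-≈ (undo x) (≤-respʳ-≈ (undo y) (+-monoˡ-≤ (- z) h))
    where
    undo : ∀ u → (u + z) + (- z) ≈ u
    undo u = ≈-trans (+-assoc u z (- z)) (≈-trans (+-congˡ (-‿inverseʳ z)) (+-identityʳ u))

  -- An inequality with a certificate: l ≤ r follows from x ≤ y as soon as l + y
  -- and r + x agree, an identity without subtraction.
  ≤-certificate : ∀ {l r x y} → l + y ≈ r + x → x ≤ y → l ≤ r
  ≤-certificate {l} {r} {x} {y} l+y≈r+x x≤y = +-cancelʳ-≤ y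
    (≤-respˡ-≈ (≈-sym l+y≈r+x) (+-mono-≤ (≤-refl {r}) x≤y))

  x≤x+y : ∀ {x y} → 0# ≤ y → x ≤ x + y
  x≤x+y {x} 0≤y = ≤-respˡ-≈ (+-identityʳ x) (+-mono-≤ ≤-refl 0≤y)

  x≤y+x : ∀ {x y} → 0# ≤ y → x ≤ y + x
  x≤y+x {x} {y} 0≤y = ≤-respʳ-≈ (+-comm x y) (x≤x+y 0≤y)

  +-nonNeg : ∀ {x y} → 0# ≤ x → 0# ≤ y → 0# ≤ x + y
  +-nonNeg 0≤x 0≤y = ≤-trans 0≤x (x≤x+y 0≤y)

  x≤0⇒0≤-x : ∀ {x} → x ≤ 0# → 0# ≤ - x
  x≤0⇒0≤-x {x} x≤0 =
    ≤-respˡ-≈ (-‿inverseʳ x) (≤-respʳ-≈ (+-identityˡ (- x)) (+-monoˡ-≤ (- x) x≤0))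

  0≤1 : 0# ≤ 1#
  0≤1 with total 0# 1#
  ... | inj₁ 0≤1 = 0≤1
  ... | inj₂ 1≤0 = ≤-respʳ-≈ square (*-nonNeg (x≤0⇒0≤-x 1≤0) (x≤0⇒0≤-x 1≤0))
    where
    square : (- 1#) * (- 1#) ≈ 1#
    square = ≈-trans (≈-sym (-‿distribˡ-* 1# (- 1#)))
      (≈-trans (-‿cong (*-identityˡ (- 1#))) (-‿involutive 1#))

  1≰0 : ¬ 1# ≤ 0#
  1≰0 1≤0 = 0≉1 (antisym 0≤1 1≤0)

  x≤y⇒0≤y-x : ∀ {x y} → x ≤ y → 0# ≤ y + (- x)
  x≤y⇒0≤y-x {x} x≤y = ≤-respˡ-≈ (-‿inverseʳ x) (+-monoˡ-≤ (- x) x≤y)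

  *-monoˡ-≤ : ∀ z {x y} → 0# ≤ z → x ≤ y → z * x ≤ z * y
  *-monoˡ-≤ z {x} {y} 0≤z x≤y = ≤-respˡ-≈ (+-identityˡ (z * x))
    (≤-respʳ-≈ cancel (+-monoˡ-≤ (z * x) (*-nonNeg 0≤z (x≤y⇒0≤y-x x≤y))))
    where
    cancel : z * (y + (- x)) + z * x ≈ z * y
    cancel = ≈-trans (≈-sym (distribˡ z _ x)) (*-congˡ
      (≈-trans (+-assoc y (- x) x) (≈-trans (+-congˡ (-‿inverseˡ x)) (+-identityʳ y))))

  -- (q - p) * (y - x) is nonnegative.
  rearrangement : ∀ {p q x y} → p ≤ q → x ≤ y → q * x + p * y ≤ q * y + p * x
  rearrangement {p} {q} {x} {y} p≤q x≤y =
    ≤-respˡ-≈ (expand x y) (≤-respʳ-≈ (≈-trans (+-congˡ (+-comm _ _)) (expand y x))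
      (+-monoˡ-≤ (p * x + p * y) (*-monoˡ-≤ d (x≤y⇒0≤y-x p≤q) x≤y)))
    where
    d : Carrier
    d = q + (- p)
    p+d≈q : p + d ≈ q
    p+d≈q = ≈-trans (+-comm p d)
      (≈-trans (+-assoc q (- p) p) (≈-trans (+-congˡ (-‿inverseˡ p)) (+-identityʳ q)))
    expand : ∀ u v → d * u + (p * u + p * v) ≈ q * u + p * v
    expand u v = ≈-trans
      (solve 4 (λ d p u v → d :* u :+ (p :* u :+ p :* v) := (p :+ d) :* u :+ p :* v)
        ≈-refl d p u v)
      (+-congʳ (*-congʳ p+d≈q))

  2# : Carrier
  2# = 1# + 1#

  2≉0 : ¬ 2# ≈ 0#
  2≉0 2≈0 = 1≰0 (≤-respʳ-≈ 2≈0 (x≤x+y 0≤1))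

  x+x≤y+y⇒x≤y : ∀ {x y} → x + x ≤ y + y → x ≤ y
  x+x≤y+y⇒x≤y {x} {y} h with total x y
  ... | inj₁ x≤y = x≤y
  ... | inj₂ y≤x = +-cancelʳ-≤ y (≤-trans (+-mono-≤ (≤-refl {x}) y≤x) h)

  half+half : ∀ x → x * 2# ⁻¹ + x * 2# ⁻¹ ≈ x
  half+half x = ≈-trans
    (solve 2 (λ x h → x :* h :+ x :* h := x :* ((con 1 :+ con 1) :* h)) ≈-refl x (2# ⁻¹))
    (≈-trans (*-congˡ (⁻¹-inverse 2# 2≉0)) (≈-trans (*-comm x 1#) (*-identityˡ x)))

  -- The supremum s of the multiples of x satisfies s ≤ s - x.
  archimedean : ∀ {x u} → (∀ k → k · x ≤ u) → x ≤ 0#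
  archimedean {x} {u} bounded = +-cancelʳ-≤ s
    (≤-respʳ-≈ (≈-sym (+-identityˡ s)) (≤-respˡ-≈ (+-comm s x) s+x≤s))
    where
    Multiple : Carrier → Set ℓ
    Multiple y = ∃ λ k → y ≈ k · x
    supremum = complete Multiple (0# , 0 , ≈-refl)
      (u , λ { y (k , y≈kx) → ≤-respˡ-≈ (≈-sym y≈kx) (bounded k) })
    s = proj₁ supremum
    s≤s-x : s ≤ s + (- x)
    s≤s-x = proj₂ (proj₂ supremum) (s + (- x)) λ { y (k , y≈kx) →
      +-cancelʳ-≤ x (≤-respʳ-≈
        (≈-sym (≈-trans (+-assoc s _ x) (≈-trans (+-congˡ (-‿inverseˡ x)) (+-identityʳ s))))
        (proj₁ (proj₂ supremum) (y + x)
          (suc k , ≈-trans (+-comm y x) (+-congˡ y≈kx)))) }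
    s+x≤s : s + x ≤ s
    s+x≤s = ≤-respʳ-≈
      (≈-trans (+-assoc s _ x) (≈-trans (+-congˡ (-‿inverseˡ x)) (+-identityʳ s)))
      (+-monoˡ-≤ x s≤s-x)

  ∃-maximum : ∀ {m} (f : Fin (suc m) → Carrier) → ∃ λ i → ∀ j → f j ≤ f i
  ∃-maximum {m} f = argmax f Fin.zero (allFin (suc m)) , λ j →
    All.lookup (f[xs]≤f[argmax] {f = f} Fin.zero (allFin (suc m))) (∈-allFin j)
    where
    totalOrder : TotalOrder ℓ ℓ ℓ
    totalOrder = record { isTotalOrder = IsDecTotalOrder.isTotalOrder isDecTotalOrder }
    open Extrema totalOrder

  module _ {A : Set} (f : A → Carrier) where

    sumOver : List A → Carrier
    sumOver []       = 0#
    sumOver (x ∷ xs) = f x + sumOver xs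

    sumOver-↭ : ∀ {xs ys} → xs ↭ ys → sumOver xs ≈ sumOver ys
    sumOver-↭ ↭.refl         = ≈-refl
    sumOver-↭ (↭.prep x p)   = +-congˡ (sumOver-↭ p)
    sumOver-↭ (↭.swap x y p) = ≈-trans (+-congˡ (+-congˡ (sumOver-↭ p)))
      (solve 3 (λ a b c → a :+ (b :+ c) := b :+ (a :+ c)) ≈-refl (f x) (f y) _)
    sumOver-↭ (↭.trans p q)  = ≈-trans (sumOver-↭ p) (sumOver-↭ q)

    sumOver-++ : ∀ xs {ys} → sumOver (xs ++ ys) ≈ sumOver xs + sumOver ys
    sumOver-++ []       = ≈-sym (+-identityˡ _)
    sumOver-++ (x ∷ xs) = ≈-trans (+-congˡ (sumOver-++ xs)) (≈-sym (+-assoc _ _ _))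

    module _ (0≤f : ∀ x → 0# ≤ f x) where

      sumOver-nonNeg : ∀ xs → 0# ≤ sumOver xs
      sumOver-nonNeg []       = ≤-refl
      sumOver-nonNeg (x ∷ xs) = +-nonNeg (0≤f x) (sumOver-nonNeg xs)

      -- A permutation brings the head of `xs` to the front of `ys`. Uniqueness keeps the tail of
      -- `xs` inside what remains of `ys`, so the induction can proceed.
      sumOver-⊆ : ∀ {xs ys} → Unique xs → xs ⊆ ys → sumOver xs ≤ sumOver ys
      sumOver-⊆ {[]}     {ys} _            _     = sumOver-nonNeg ys
      sumOver-⊆ {x ∷ xs} {ys} (x∉xs ∷ uxs) xs⊆ys with ∈-∃++ (xs⊆ys (here ≡.refl))
      ... | ys₁ , ys₂ , ≡.refl = ≤-respʳ-≈ (≈-sym (sumOver-↭ (↭ₚ.shift x ys₁ ys₂)))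
        (+-mono-≤ ≤-refl (sumOver-⊆ uxs tail⊆))
        where
        tail⊆ : xs ⊆ (ys₁ ++ ys₂)
        tail⊆ u∈xs with ↭ₚ.∈-resp-↭ (↭ₚ.shift x ys₁ ys₂) (xs⊆ys (there u∈xs))
        ... | here ≡.refl = contradiction ≡.refl (All.lookup x∉xs u∈xs)
        ... | there u∈    = u∈

-- Walks on a weighted cycle and lower bounds for their cost.

module CycleWalks {ℓ} (R : RealField ℓ) (Γ : Exploration.Cycle R) where

  open RealField R
  open OrderedField R
  open Exploration R
  open Cycle Γ

  open DecMembership (_≟ᶠ_ {n}) using (_∈?_)

  -- Rotations of the cycle

  [m%n+o]%n≡[m+o]%n : ∀ m o → (m % n ℕ.+ o) % n ≡ (m ℕ.+ o) % n
  [m%n+o]%n≡[m+o]%n m o = begin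
    (m % n ℕ.+ o) % n              ≡⟨ %-distribˡ-+ (m % n) o n ⟩
    (m % n % n ℕ.+ o % n) % n      ≡⟨ cong (λ z → (z ℕ.+ o % n) % n) (m%n%n≡m%n m n) ⟩
    (m % n ℕ.+ o % n) % n          ≡⟨ %-distribˡ-+ m o n ⟨
    (m ℕ.+ o) % n                  ∎
    where open ≡.≡-Reasoning

  toℕ-move-cw : ∀ v → toℕ (move cw v) ≡ suc (toℕ v) % n
  toℕ-move-cw v = toℕ-fromℕ< _

  toℕ-move-ccw : ∀ v → toℕ (move ccw v) ≡ (toℕ v ℕ.+ (2 ℕ.+ extra)) % n
  toℕ-move-ccw v = toℕ-fromℕ< _

  toℕ+n%n : ∀ v → (toℕ v ℕ.+ n) % n ≡ toℕ v
  toℕ+n%n v = ≡.trans ([m+n]%n≡m%n (toℕ v) n) (m<n⇒m%n≡m (toℕ<n v))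

  move-opposite : ∀ δ v → move (opposite δ) (move δ v) ≡ v
  move-opposite cw v = toℕ-injective (begin
    toℕ (move ccw (move cw v))                   ≡⟨ toℕ-move-ccw (move cw v) ⟩
    (toℕ (move cw v) ℕ.+ (2 ℕ.+ extra)) % n
      ≡⟨ cong (λ z → (z ℕ.+ (2 ℕ.+ extra)) % n) (toℕ-move-cw v) ⟩
    (suc (toℕ v) % n ℕ.+ (2 ℕ.+ extra)) % n      ≡⟨ [m%n+o]%n≡[m+o]%n (suc (toℕ v)) _ ⟩
    (suc (toℕ v) ℕ.+ (2 ℕ.+ extra)) % n          ≡⟨ cong (_% n) (ℕₚ.+-suc (toℕ v) _) ⟨
    (toℕ v ℕ.+ n) % n                            ≡⟨ toℕ+n%n v ⟩
    toℕ v                                        ∎)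
    where open ≡.≡-Reasoning
  move-opposite ccw v = toℕ-injective (begin
    toℕ (move cw (move ccw v))                   ≡⟨ toℕ-move-cw (move ccw v) ⟩
    suc (toℕ (move ccw v)) % n                   ≡⟨ cong (λ z → suc z % n) (toℕ-move-ccw v) ⟩
    suc ((toℕ v ℕ.+ (2 ℕ.+ extra)) % n) % n
      ≡⟨ cong (_% n) (ℕₚ.+-comm 1 ((toℕ v ℕ.+ (2 ℕ.+ extra)) % n)) ⟩
    ((toℕ v ℕ.+ (2 ℕ.+ extra)) % n ℕ.+ 1) % n    ≡⟨ [m%n+o]%n≡[m+o]%n (toℕ v ℕ.+ (2 ℕ.+ extra)) 1 ⟩
    (toℕ v ℕ.+ (2 ℕ.+ extra) ℕ.+ 1) % n
      ≡⟨ cong (_% n) (≡.trans (ℕₚ.+-assoc (toℕ v) _ 1) (cong (toℕ v ℕ.+_) (ℕₚ.+-comm _ 1))) ⟩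
    (toℕ v ℕ.+ n) % n                            ≡⟨ toℕ+n%n v ⟩
    toℕ v                                        ∎)
    where open ≡.≡-Reasoning

  toℕ-endpoint-cw : ∀ q v → toℕ (endpoint v (replicate q cw)) ≡ (toℕ v ℕ.+ q) % n
  toℕ-endpoint-cw zero    v =
    ≡.sym (≡.trans (cong (_% n) (ℕₚ.+-identityʳ (toℕ v))) (m<n⇒m%n≡m (toℕ<n v)))
  toℕ-endpoint-cw (suc q) v = begin
    toℕ (endpoint (move cw v) (replicate q cw))  ≡⟨ toℕ-endpoint-cw q (move cw v) ⟩
    (toℕ (move cw v) ℕ.+ q) % n                  ≡⟨ cong (λ z → (z ℕ.+ q) % n) (toℕ-move-cw v) ⟩
    (suc (toℕ v) % n ℕ.+ q) % n                  ≡⟨ [m%n+o]%n≡[m+o]%n (suc (toℕ v)) q ⟩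
    (suc (toℕ v) ℕ.+ q) % n                      ≡⟨ cong (_% n) (ℕₚ.+-suc (toℕ v) q) ⟨
    (toℕ v ℕ.+ suc q) % n                        ∎
    where open ≡.≡-Reasoning

  -- The number of clockwise steps from v to u.
  offset : Vertex → Vertex → ℕ
  offset v u = (toℕ u ℕ.+ (n ∸ toℕ v)) % n

  offset<n : ∀ v u → offset v u ℕ.< n
  offset<n v u = m%n<n (toℕ u ℕ.+ (n ∸ toℕ v)) n

  -- Together with `offset-endpoint`, this puts the vertices in bijection with the clockwise walks
  -- from `v` of fewer than `n` steps.
  endpoint-offset : ∀ v u → endpoint v (replicate (offset v u) cw) ≡ u
  endpoint-offset v u = toℕ-injective (begin
    toℕ (endpoint v (replicate (offset v u) cw))     ≡⟨ toℕ-endpoint-cw (offset v u) v ⟩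
    (toℕ v ℕ.+ offset v u) % n                       ≡⟨ cong (_% n) (ℕₚ.+-comm (toℕ v) _) ⟩
    (offset v u ℕ.+ toℕ v) % n
      ≡⟨ [m%n+o]%n≡[m+o]%n (toℕ u ℕ.+ (n ∸ toℕ v)) (toℕ v) ⟩
    (toℕ u ℕ.+ (n ∸ toℕ v) ℕ.+ toℕ v) % n            ≡⟨ cong (_% n) (ℕₚ.+-assoc (toℕ u) _ _) ⟩
    (toℕ u ℕ.+ ((n ∸ toℕ v) ℕ.+ toℕ v)) % n
      ≡⟨ cong (λ z → (toℕ u ℕ.+ z) % n) (ℕₚ.m∸n+n≡m (ℕₚ.<⇒≤ (toℕ<n v))) ⟩
    (toℕ u ℕ.+ n) % n                                ≡⟨ toℕ+n%n u ⟩
    toℕ u                                            ∎)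
    where open ≡.≡-Reasoning

  offset-endpoint : ∀ v {q} → q ℕ.< n → offset v (endpoint v (replicate q cw)) ≡ q
  offset-endpoint v {q} q<n = begin
    (toℕ (endpoint v (replicate q cw)) ℕ.+ (n ∸ toℕ v)) % n
      ≡⟨ cong (λ z → (z ℕ.+ (n ∸ toℕ v)) % n) (toℕ-endpoint-cw q v) ⟩
    ((toℕ v ℕ.+ q) % n ℕ.+ (n ∸ toℕ v)) % n          ≡⟨ [m%n+o]%n≡[m+o]%n (toℕ v ℕ.+ q) _ ⟩
    (toℕ v ℕ.+ q ℕ.+ (n ∸ toℕ v)) % n
      ≡⟨ cong (λ z → (z ℕ.+ (n ∸ toℕ v)) % n) (ℕₚ.+-comm (toℕ v) q) ⟩
    (q ℕ.+ toℕ v ℕ.+ (n ∸ toℕ v)) % n                ≡⟨ cong (_% n) (ℕₚ.+-assoc q _ _) ⟩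
    (q ℕ.+ (toℕ v ℕ.+ (n ∸ toℕ v))) % n
      ≡⟨ cong (λ z → (q ℕ.+ z) % n) (ℕₚ.m+[n∸m]≡n (ℕₚ.<⇒≤ (toℕ<n v))) ⟩
    (q ℕ.+ n) % n                                    ≡⟨ [m+n]%n≡m%n q n ⟩
    q % n                                            ≡⟨ m<n⇒m%n≡m q<n ⟩
    q                                                ∎
    where open ≡.≡-Reasoning

  endpoint-cw-n : ∀ v → endpoint v (replicate n cw) ≡ v
  endpoint-cw-n v = toℕ-injective (≡.trans (toℕ-endpoint-cw n v) (toℕ+n%n v))

  -- Walks

  replicate-+ : ∀ a b {δ : Dir} → replicate (a ℕ.+ b) δ ≡ replicate a δ ++ replicate b δ
  replicate-+ zero    b = ≡.refl
  replicate-+ (suc a) b = cong (_ ∷_) (replicate-+ a b)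

  replicate-∷ʳ : ∀ k {δ : Dir} → replicate (suc k) δ ≡ replicate k δ ++ [ δ ]
  replicate-∷ʳ k {δ} = ≡.trans (cong (λ m → replicate m δ) (ℕₚ.+-comm 1 k)) (replicate-+ k 1)

  endpoint-++ : ∀ v p {q} → endpoint v (p ++ q) ≡ endpoint (endpoint v p) q
  endpoint-++ v []      = ≡.refl
  endpoint-++ v (δ ∷ p) = endpoint-++ (move δ v) p

  endpoint-suc : ∀ v k {δ} → endpoint v (replicate (suc k) δ) ≡ move δ (endpoint v (replicate k δ))
  endpoint-suc v k = ≡.trans (cong (endpoint v) (replicate-∷ʳ k)) (endpoint-++ v (replicate k _))

  -- An edge is named by its counterclockwise end.
  edge : Dir → Vertex → Vertex
  edge cw  v = v
  edge ccw v = move ccw v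

  -- Since an edge has the same name in both directions, two walks have equal cost as soon as their
  -- edge lists are permutations of each other.
  edges : Vertex → List Dir → List Vertex
  edges v []      = []
  edges v (δ ∷ p) = edge δ v ∷ edges (move δ v) p

  edges-++ : ∀ v p {q} → edges v (p ++ q) ≡ edges v p ++ edges (endpoint v p) q
  edges-++ v []      = ≡.refl
  edges-++ v (δ ∷ p) = cong (edge δ v ∷_) (edges-++ (move δ v) p)

  edgeWeight≡ : ∀ δ v → edgeWeight δ v ≡ weight (edge δ v)
  edgeWeight≡ cw  v = ≡.refl
  edgeWeight≡ ccw v = ≡.refl

  edgeWeight-nonNeg : ∀ δ v → 0# ≤ edgeWeight δ v
  edgeWeight-nonNeg cw  v = weight-nonNeg v
  edgeWeight-nonNeg ccw v = weight-nonNeg (move ccw v)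

  cost≈sum : ∀ v p → cost v p ≈ sumOver weight (edges v p)
  cost≈sum v []      = ≈-refl
  cost≈sum v (δ ∷ p) = +-cong (≈-reflexive (edgeWeight≡ δ v)) (cost≈sum (move δ v) p)

  cost-↭ : ∀ v p u q → edges v p ↭ edges u q → cost v p ≈ cost u q
  cost-↭ v p u q vp↭uq =
    ≈-trans (cost≈sum v p) (≈-trans (sumOver-↭ weight vp↭uq) (≈-sym (cost≈sum u q)))

  cost-nonNeg : ∀ v p → 0# ≤ cost v p
  cost-nonNeg v p = ≤-respʳ-≈ (≈-sym (cost≈sum v p)) (sumOver-nonNeg weight weight-nonNeg (edges v p))

  cost-++ : ∀ v p {q} → cost v (p ++ q) ≈ cost v p + cost (endpoint v p) q
  cost-++ v []      = ≈-sym (+-identityˡ _)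
  cost-++ v (δ ∷ p) = ≈-trans (+-congˡ (cost-++ (move δ v) p)) (≈-sym (+-assoc _ _ _))

  cost-suc : ∀ v k δ → cost v (replicate (suc k) δ)
    ≈ cost v (replicate k δ) + edgeWeight δ (endpoint v (replicate k δ))
  cost-suc v k δ = ≈-trans (≈-reflexive (cong (cost v) (replicate-∷ʳ k)))
    (≈-trans (cost-++ v (replicate k δ)) (+-congˡ (+-identityʳ _)))

  edge-opposite : ∀ δ v → edge (opposite δ) (move δ v) ≡ edge δ v
  edge-opposite cw  v = move-opposite cw v
  edge-opposite ccw v = ≡.refl

  endpoint-retrace : ∀ v k δ →
    endpoint (endpoint v (replicate k δ)) (replicate k (opposite δ)) ≡ v
  endpoint-retrace v zero    δ = ≡.refl
  endpoint-retrace v (suc k) δ = ≡.trans (endpoint-suc _ k)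
    (≡.trans (cong (move (opposite δ)) (endpoint-retrace (move δ v) k δ)) (move-opposite δ v))

  -- The way back meets the same edges in reverse order: its last edge is the first edge of the way
  -- out, and the others are covered by induction.
  edges-retrace : ∀ v k δ →
    edges (endpoint v (replicate k δ)) (replicate k (opposite δ)) ↭ edges v (replicate k δ)
  edges-retrace v zero    δ = ↭.refl
  edges-retrace v (suc k) δ = begin
    edges z (replicate (suc k) (opposite δ))
      ≡⟨ cong (edges z) (replicate-∷ʳ k) ⟩
    edges z (replicate k (opposite δ) ++ [ opposite δ ])
      ≡⟨ edges-++ z (replicate k (opposite δ)) ⟩
    edges z (replicate k (opposite δ)) ++ [ edge (opposite δ) (endpoint z (replicate k (opposite δ))) ]
      ≡⟨ cong (λ x → edges z (replicate k (opposite δ)) ++ [ x ])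
           (≡.trans (cong (edge (opposite δ)) (endpoint-retrace (move δ v) k δ)) (edge-opposite δ v)) ⟩
    edges z (replicate k (opposite δ)) ++ [ edge δ v ]
      ↭⟨ ↭ₚ.++-comm _ [ edge δ v ] ⟩
    edge δ v ∷ edges z (replicate k (opposite δ))
      ↭⟨ ↭.prep _ (edges-retrace (move δ v) k δ) ⟩
    edge δ v ∷ edges (move δ v) (replicate k δ) ∎
    where
    open ↭.PermutationReasoning
    z : Vertex
    z = endpoint (move δ v) (replicate k δ)

  cost-retrace : ∀ v k δ →
    cost (endpoint v (replicate k δ)) (replicate k (opposite δ)) ≈ cost v (replicate k δ)
  cost-retrace v k δ = cost-↭ _ _ _ _ (edges-retrace v k δ)

  endpoint-n : ∀ δ v → endpoint v (replicate n δ) ≡ v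
  endpoint-n cw  v = endpoint-cw-n v
  endpoint-n ccw v = ≡.trans
    (cong (λ u → endpoint u (replicate n ccw)) (≡.sym (endpoint-cw-n v))) (endpoint-retrace v n cw)

  -- A clockwise round ends where it began, so the counterclockwise round from `v` retraces it.
  edges-n : ∀ δ v → edges v (replicate n δ) ↭ edges v (replicate n cw)
  edges-n cw  v = ↭.refl
  edges-n ccw v = ↭.trans
    (↭.↭-reflexive (cong (λ u → edges u (replicate n ccw)) (≡.sym (endpoint-cw-n v))))
    (edges-retrace v n cw)

  length : Vertex → Carrier
  length v = cost v (replicate n cw)

  cost-n : ∀ δ v → cost v (replicate n δ) ≈ length v
  cost-n δ v = cost-↭ v (replicate n δ) v (replicate n cw) (edges-n δ v)

  -- Shifting the start by one step makes the first edge of the round its last one.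
  length-move : ∀ v → length (move cw v) ≈ length v
  length-move v = ≈-trans (cost-suc (move cw v) (2 ℕ.+ extra) cw)
    (≈-trans (+-comm _ _) (+-congʳ (≈-reflexive (cong weight (endpoint-cw-n v)))))

  length-endpoint : ∀ v q → length (endpoint v (replicate q cw)) ≈ length v
  length-endpoint v zero    = ≈-refl
  length-endpoint v (suc q) = ≈-trans (length-endpoint (move cw v) q) (length-move v)

  length-const : ∀ v u → length u ≈ length v
  length-const v u = subst (λ x → length x ≈ length v) (endpoint-offset v u)
    (length-endpoint v (offset v u))

  edge∈edges : ∀ v p {q δ} → edge δ (endpoint v p) ∈ edges v (p ++ δ ∷ q)
  edge∈edges v []      = here ≡.refl
  edge∈edges v (γ ∷ p) = there (edge∈edges (move γ v) p)

  endpoint∈visited : ∀ v p {q} → endpoint v p ∈ visited v (p ++ q)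
  endpoint∈visited v []      {[]}    = here ≡.refl
  endpoint∈visited v []      {_ ∷ _} = here ≡.refl
  endpoint∈visited v (δ ∷ p)         = there (endpoint∈visited (move δ v) p)

  -- A clockwise round reaches `u` after `offset v u` steps, and the next step traverses the edge
  -- named `u`.
  ∈edges-n : ∀ δ v u → u ∈ edges v (replicate n δ)
  ∈edges-n δ v u = ↭ₚ.∈-resp-↭ (↭.↭-sym (edges-n δ v)) u∈
    where
    m : ℕ
    m = offset v u
    split : replicate n cw ≡ replicate m cw ++ cw ∷ replicate (n ∸ suc m) cw
    split = ≡.trans (cong (λ k → replicate k cw)
      (≡.sym (≡.trans (ℕₚ.+-suc m _) (ℕₚ.m+[n∸m]≡n (offset<n v u))))) (replicate-+ m _)
    u∈ : u ∈ edges v (replicate n cw)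
    u∈ = ≡.subst₂ (λ x p → x ∈ edges v p) (endpoint-offset v u) (≡.sym split)
      (edge∈edges v (replicate m cw))

  edges-cw : ∀ v q →
    edges v (replicate q cw) ≡ applyUpTo (λ k → endpoint v (replicate k cw)) q
  edges-cw v zero    = ≡.refl
  edges-cw v (suc q) = cong (v ∷_) (edges-cw (move cw v) q)

  -- `offset v` recovers `k` from the vertex reached after `k` < `n` steps, so no vertex repeats.
  edges-n-unique : ∀ v → Unique (edges v (replicate n cw))
  edges-n-unique v = subst Unique (≡.sym (edges-cw v n))
    (Uniqueₚ.applyUpTo⁺₁ (λ k → endpoint v (replicate k cw)) n λ {i} {j} i<j j<n eq → ℕₚ.<⇒≢ i<j
      (≡.trans (≡.sym (offset-endpoint v (ℕₚ.<-trans i<j j<n)))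
        (≡.trans (cong (offset v) eq) (offset-endpoint v j<n))))

  length≤cost : ∀ s v p → (∀ u → u ∈ edges v p) → length s ≤ cost v p
  length≤cost s v p covers = ≤-respˡ-≈ (≈-sym (cost≈sum s (replicate n cw))) (≤-respʳ-≈ (≈-sym (cost≈sum v p))
    (sumOver-⊆ weight weight-nonNeg (edges-n-unique s) (λ {u} _ → covers u)))

  visited-⊎ : ∀ v p {q u} → u ∈ visited v (p ++ q) →
    u ∈ visited v p ⊎ u ∈ visited (endpoint v p) q
  visited-⊎ v []      u∈           = inj₂ u∈
  visited-⊎ v (δ ∷ p) (here eq)    = inj₁ (here eq)
  visited-⊎ v (δ ∷ p) (there u∈)   with visited-⊎ (move δ v) p u∈
  ... | inj₁ u∈p = inj₁ (there u∈p)
  ... | inj₂ u∈q = inj₂ u∈q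

  visited-split : ∀ v p {u} → u ∈ visited v p → ∃₂ λ q r → p ≡ q ++ r × endpoint v q ≡ u
  visited-split v []      (here eq)  = [] , [] , ≡.refl , ≡.sym eq
  visited-split v (δ ∷ p) (here eq)  = [] , δ ∷ p , ≡.refl , ≡.sym eq
  visited-split v (δ ∷ p) (there u∈) with visited-split (move δ v) p u∈
  ... | q , r , ≡.refl , eq = δ ∷ q , r , ≡.refl , eq

  -- The cycle without the edge e

  module Cut (e : Vertex) where

    head : Vertex
    head = move cw e

    rest : Carrier
    rest = cost head (replicate (2 ℕ.+ extra) cw)

    -- A round that starts at `e` splits by definition into the edge `e` and `rest`; only the start
    -- vertex has to be changed.
    length≈weight+rest : ∀ v → length v ≈ weight e + rest
    length≈weight+rest v = length-const e v

    -- Without the edge `e` the cycle is a path from `head` to the vertex `e`. The potential is the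
    -- coordinate along this path, running from 0 to `rest`.
    potential : Vertex → Carrier
    potential u = cost head (replicate (offset head u) cw)

    offset-e : offset head e ≡ 2 ℕ.+ extra
    offset-e = ≡.trans (cong (offset head) (≡.sym (endpoint-cw-n e)))
      (offset-endpoint head ℕₚ.≤-refl)

    potential-e : potential e ≡ rest
    potential-e = cong (λ k → cost head (replicate k cw)) offset-e

    potential-head : potential head ≡ 0#
    potential-head = cong (λ k → cost head (replicate k cw)) (offset-endpoint head {0} (s≤s z≤n))

    potential-move : ∀ u → u ≢ e → potential (move cw u) ≈ potential u + weight u
    potential-move u u≢e = ≈-trans
      (≈-reflexive (cong (λ k → cost head (replicate k cw)) offset-move))
      (≈-trans (cost-suc head q cw) (+-congˡ (≈-reflexive (cong weight (endpoint-offset head u)))))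
      where
      q : ℕ
      q = offset head u
      -- Only `e` has the largest offset, so the step from `u` does not wrap around to offset 0.
      q≢ : q ≢ 2 ℕ.+ extra
      q≢ q≡ = u≢e (≡.trans (≡.sym (endpoint-offset head u))
        (≡.trans (cong (λ k → endpoint head (replicate k cw)) (≡.trans q≡ (≡.sym offset-e)))
          (endpoint-offset head e)))
      1+q<n : suc q ℕ.< n
      1+q<n = s≤s (ℕₚ.≤∧≢⇒< (ℕₚ.≤-pred (offset<n head u)) q≢)
      offset-move : offset head (move cw u) ≡ suc q
      offset-move = ≡.trans
        (cong (λ x → offset head (move cw x)) (≡.sym (endpoint-offset head u)))
        (≡.trans (cong (offset head) (≡.sym (endpoint-suc head q)))
          (offset-endpoint head 1+q<n))

    -- The two inequalities together bound the absolute change of the potential by the cost of the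
    -- step.
    potential-step : ∀ δ v → edge δ v ≢ e →
      potential (move δ v) ≤ potential v + edgeWeight δ v ×
      potential v ≤ potential (move δ v) + edgeWeight δ v
    potential-step cw  v v≢e =
      ≤-reflexive (potential-move v v≢e) ,
      ≤-trans (x≤x+y (weight-nonNeg v))
        (+-mono-≤ (≤-respʳ-≈ (≈-sym (potential-move v v≢e)) (x≤x+y (weight-nonNeg v))) ≤-refl)
    potential-step ccw v u≢e =
      ≤-trans (x≤x+y 0≤w) (+-mono-≤ (≤-respʳ-≈ (≈-sym up) (x≤x+y 0≤w)) ≤-refl) ,
      ≤-reflexive up
      where
      u  = move ccw v
      0≤w = weight-nonNeg u
      up : potential v ≈ potential u + weight u
      up = ≈-trans (≈-reflexive (cong potential (≡.sym (move-opposite ccw v)))) (potential-move u u≢e)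

    potential-walk : ∀ v p → e ∉ edges v p →
      potential (endpoint v p) ≤ potential v + cost v p ×
      potential v ≤ potential (endpoint v p) + cost v p
    potential-walk v []      _  = x≤x+y ≤-refl , x≤x+y ≤-refl
    potential-walk v (δ ∷ p) e∉ with potential-step δ v (λ eq → e∉ (here (≡.sym eq)))
                                   | potential-walk (move δ v) p (λ e∈ → e∉ (there e∈))
    ... | up , down | ups , downs =
      ≤-trans ups (≤-respʳ-≈ (+-assoc _ _ _) (+-mono-≤ up ≤-refl)) ,
      ≤-trans down (≤-respʳ-≈
        (solve 3 (λ x c w → x :+ c :+ w := x :+ (w :+ c)) ≈-refl _ _ _) (+-mono-≤ downs ≤-refl))

    potential-between : ∀ {a b} p → endpoint a p ≡ b → e ∉ edges a p →
      potential b ≤ potential a + cost a p × potential a ≤ potential b + cost a p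
    potential-between {a} p ≡.refl e∉ = potential-walk a p e∉

    -- A closed walk through `x` and `y` climbs from one to the other and comes back. It is cut at
    -- `v`, `x` and `y` into three pieces, in one of two orders; when the bounds for the pieces are
    -- added, the potential of `v` cancels.
    double-potential : ∀ v p {x y} → endpoint v p ≡ v → e ∉ edges v p →
      x ∈ visited v p → y ∈ visited v p →
      potential y + potential y ≤ (potential x + potential x) + cost v p
    double-potential v p {x} {y} closed e∉ x∈ y∈ with visited-split v p x∈
    ... | q , r , ≡.refl , v→x = either (visited-⊎ v q y∈)
      where
      e∉q : e ∉ edges v q
      e∉q e∈ = e∉ (subst (e ∈_) (≡.sym (edges-++ v q)) (∈-++⁺ˡ e∈))
      e∉r : e ∉ edges x r
      e∉r e∈ = e∉ (subst (e ∈_) (≡.sym (edges-++ v q))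
        (∈-++⁺ʳ (edges v q) (subst (λ z → e ∈ edges z r) (≡.sym v→x) e∈)))
      x→v : endpoint x r ≡ v
      x→v = ≡.trans (cong (λ z → endpoint z r) (≡.sym v→x)) (≡.trans (≡.sym (endpoint-++ v q)) closed)
      cost-split : cost v (q ++ r) ≈ cost v q + cost x r
      cost-split = ≈-trans (cost-++ v q) (+-congˡ (≈-reflexive (cong (λ z → cost z r) v→x)))

      either : y ∈ visited v q ⊎ y ∈ visited (endpoint v q) r →
        potential y + potential y ≤ (potential x + potential x) + cost v (q ++ r)
      either (inj₁ y∈q) with visited-split v q y∈q
      ... | q₁ , q₂ , ≡.refl , v→y = ≤-respʳ-≈ (+-congˡ (≈-sym (≈-trans cost-split (+-congʳ q-split))))
        (≤-certificate
          (solve 6 (λ x y v a b c →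
            y :+ y :+ (v :+ a :+ (x :+ b) :+ (x :+ c)) := x :+ x :+ (a :+ b :+ c) :+ (y :+ y :+ v))
            ≈-refl (potential x) (potential y) (potential v) _ _ _)
          (+-mono-≤ (+-mono-≤
            (proj₁ (potential-between q₁ v→y λ e∈ →
              e∉q (subst (e ∈_) (≡.sym (edges-++ v q₁)) (∈-++⁺ˡ e∈))))
            (proj₂ (potential-between q₂ y→x λ e∈ →
              e∉q (subst (e ∈_) (≡.sym (edges-++ v q₁)) (∈-++⁺ʳ (edges v q₁)
                (subst (λ z → e ∈ edges z q₂) (≡.sym v→y) e∈))))))
            (proj₁ (potential-between r x→v e∉r))))
        where
        y→x : endpoint y q₂ ≡ x
        y→x = ≡.trans (cong (λ z → endpoint z q₂) (≡.sym v→y)) (≡.trans (≡.sym (endpoint-++ v q₁)) v→x)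
        q-split : cost v (q₁ ++ q₂) ≈ cost v q₁ + cost y q₂
        q-split = ≈-trans (cost-++ v q₁) (+-congˡ (≈-reflexive (cong (λ z → cost z q₂) v→y)))
      either (inj₂ y∈r) with visited-split x r (subst (λ z → y ∈ visited z r) v→x y∈r)
      ... | r₁ , r₂ , ≡.refl , x→y = ≤-respʳ-≈ (+-congˡ (≈-sym (≈-trans cost-split (+-congˡ r-split))))
        (≤-certificate
          (solve 6 (λ x y v a b c →
            y :+ y :+ (x :+ a :+ (x :+ b) :+ (v :+ c)) := x :+ x :+ (a :+ (b :+ c)) :+ (v :+ y :+ y))
            ≈-refl (potential x) (potential y) (potential v) _ _ _)
          (+-mono-≤ (+-mono-≤
            (proj₂ (potential-between q v→x e∉q))
            (proj₁ (potential-between r₁ x→y λ e∈ →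
              e∉r (subst (e ∈_) (≡.sym (edges-++ x r₁)) (∈-++⁺ˡ e∈)))))
            (proj₂ (potential-between r₂ y→v λ e∈ →
              e∉r (subst (e ∈_) (≡.sym (edges-++ x r₁)) (∈-++⁺ʳ (edges x r₁)
                (subst (λ z → e ∈ edges z r₂) (≡.sym x→y) e∈)))))))
        where
        y→v : endpoint y r₂ ≡ v
        y→v = ≡.trans (cong (λ z → endpoint z r₂) (≡.sym x→y)) (≡.trans (≡.sym (endpoint-++ x r₁)) x→v)
        r-split : cost x (r₁ ++ r₂) ≈ cost x r₁ + cost y r₂
        r-split = ≈-trans (cost-++ x r₁) (+-congˡ (≈-reflexive (cong (λ z → cost z r₂) x→y)))

    rest+rest≤cost : ∀ v p → IsTour v p → e ∉ edges v p → rest + rest ≤ cost v p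
    rest+rest≤cost v p (closed , all) e∉ =
      ≤-respˡ-≈ (≈-reflexive (cong (λ z → z + z) potential-e)) (≤-respʳ-≈ (≈-trans
        (+-congʳ (≈-trans (≈-reflexive (cong (λ z → z + z) potential-head)) (+-identityˡ 0#)))
        (+-identityˡ _))
        (double-potential v p closed e∉ (all head) (all e)))

    doubleTour : List Dir
    doubleTour = replicate (2 ℕ.+ extra) cw ++ replicate (2 ℕ.+ extra) ccw

    doubleTour-isTour : IsTour head doubleTour
    doubleTour-isTour =
      ≡.trans (endpoint-++ head (replicate (2 ℕ.+ extra) cw)) (endpoint-retrace head (2 ℕ.+ extra) cw) ,
      λ u → let q = offset head u in
        ≡.subst₂ (λ x p → x ∈ visited head p) (endpoint-offset head u)
          (≡.trans (≡.sym (++-assoc (replicate q cw) _ _))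
            (cong (_++ replicate (2 ℕ.+ extra) ccw) (≡.trans (≡.sym (replicate-+ q _))
              (cong (λ k → replicate k cw) (ℕₚ.m+[n∸m]≡n (ℕₚ.≤-pred (offset<n head u)))))))
          (endpoint∈visited head (replicate q cw))

    cost-doubleTour : cost head doubleTour ≈ rest + rest
    cost-doubleTour = ≈-trans (cost-++ head (replicate (2 ℕ.+ extra) cw))
      (+-congˡ (cost-retrace head (2 ℕ.+ extra) cw))

  -- Optimal tours: once round, or twice along all edges but a heaviest one.

  roundTour-isTour : ∀ s → IsTour s (replicate n cw)
  roundTour-isTour s = endpoint-cw-n s , λ u → let q = offset s u in
    ≡.subst₂ (λ x p → x ∈ visited s p) (endpoint-offset s u)
      (≡.trans (≡.sym (replicate-+ q _))
        (cong (λ k → replicate k cw) (ℕₚ.m+[n∸m]≡n (ℕₚ.<⇒≤ (offset<n s u)))))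
      (endpoint∈visited s (replicate q cw))

  length⊎rest≤cost : ∀ s v p → IsTour v p →
    length s ≤ cost v p ⊎ ∃ λ e → Cut.rest e + Cut.rest e ≤ cost v p
  length⊎rest≤cost s v p tour with all? (λ u → u ∈? edges v p)
  ... | yes covers = inj₁ (length≤cost s v p covers)
  ... | no ¬covers with ¬∀⟶∃¬ n _ (λ u → u ∈? edges v p) ¬covers
  ...   | e , e∉ = inj₂ (e , Cut.rest+rest≤cost e v p tour e∉)

  -- An edge and its `rest` always add up to the length of the cycle. Hence among the doubled paths
  -- the one that omits a heaviest edge is the shortest.
  rest-antitone : ∀ {e u} → weight u ≤ weight e → Cut.rest e ≤ Cut.rest u
  rest-antitone {e} {u} = ≤-certificate {Cut.rest e} {Cut.rest u} {weight u} {weight e}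
    (≈-trans (+-comm (Cut.rest e) (weight e))
      (≈-trans (≈-sym (Cut.length≈weight+rest e u))
        (≈-trans (Cut.length≈weight+rest u u) (+-comm (weight u) (Cut.rest u)))))

  IsOpt-length : ∀ s e → (∀ u → weight u ≤ weight e) →
    length s ≤ Cut.rest e + Cut.rest e → IsOpt (length s)
  IsOpt-length s e heaviest round≤ = (s , replicate n cw , roundTour-isTour s , ≈-refl) , lower
    where
    lower : ∀ v p → IsTour v p → length s ≤ cost v p
    lower v p tour with length⊎rest≤cost s v p tour
    ... | inj₁ h       = h
    ... | inj₂ (u , h) = ≤-trans round≤
      (≤-trans (+-mono-≤ (rest-antitone (heaviest u)) (rest-antitone (heaviest u))) h)

  IsOpt-rest : ∀ s e → (∀ u → weight u ≤ weight e) →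
    Cut.rest e + Cut.rest e ≤ length s → IsOpt (Cut.rest e + Cut.rest e)
  IsOpt-rest s e heaviest double≤ =
    (Cut.head e , Cut.doubleTour e , Cut.doubleTour-isTour e , Cut.cost-doubleTour e) , lower
    where
    lower : ∀ v p → IsTour v p → Cut.rest e + Cut.rest e ≤ cost v p
    lower v p tour with length⊎rest≤cost s v p tour
    ... | inj₁ h       = ≤-trans double≤ h
    ... | inj₂ (u , h) =
      ≤-trans (+-mono-≤ (rest-antitone (heaviest u)) (rest-antitone (heaviest u))) h

  -- The last component records which of the two candidates is optimal, because the upper bound
  -- treats them separately.
  optimum : ∀ s → ∃ λ o → IsOpt o × (o ≈ length s ⊎ ∃ λ e → o ≈ Cut.rest e + Cut.rest e)
  optimum s = choose (∃-maximum weight)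
    where
    choose : (∃ λ e → ∀ u → weight u ≤ weight e) →
      ∃ λ o → IsOpt o × (o ≈ length s ⊎ ∃ λ e → o ≈ Cut.rest e + Cut.rest e)
    choose (e , heaviest) with total (length s) (Cut.rest e + Cut.rest e)
    ... | inj₁ round≤  = length s , IsOpt-length s e heaviest round≤ , inj₁ ≈-refl
    ... | inj₂ double≤ = Cut.rest e + Cut.rest e , IsOpt-rest s e heaviest double≤ , inj₂ (e , ≈-refl)

-- Estimates for the square root of three.

IsSquareRootOfThree : ∀ {ℓ} (R : RealField ℓ) → RealField.Carrier R → Set ℓ
IsSquareRootOfThree R t = 0# ≤ t × t * t ≈ 1# + 1# + 1#
  where open RealField R

module SquareRootOfThree {ℓ} (R : RealField ℓ) (t : RealField.Carrier R)
  (isRoot : IsSquareRootOfThree R t) where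

  open RealField R
  open OrderedField R

  0≤t : 0# ≤ t
  0≤t = proj₁ isRoot

  t²≈3 : t * t ≈ 1# + 1# + 1#
  t²≈3 = proj₂ isRoot

  -- If t ≤ 1, then 3 = t² ≤ t ≤ 1, hence 2 ≤ 0.
  1≤t : 1# ≤ t
  1≤t with total 1# t
  ... | inj₁ 1≤t = 1≤t
  ... | inj₂ t≤1 = contradiction (antisym 2≤0 (+-nonNeg 0≤1 0≤1)) 2≉0
    where
    2≤0 : 2# ≤ 0#
    2≤0 = ≤-certificate
      (solve 1 (λ t → con 1 :+ con 1 :+ (t :* con 1 :+ con 1) :=
        con 0 :+ (con 1 :+ con 1 :+ con 1 :+ t)) ≈-refl t)
      (+-mono-≤ (≤-respˡ-≈ t²≈3 (*-monoˡ-≤ t 0≤t t≤1)) t≤1)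

  x≤tx : ∀ {x} → 0# ≤ x → x ≤ t * x
  x≤tx {x} 0≤x = ≤-respˡ-≈ (≈-trans (*-comm x 1#) (*-identityˡ x))
    (≤-respʳ-≈ (*-comm x t) (*-monoˡ-≤ x 0≤x 1≤t))

  -- Makes 3 - t non-negative. In `account-return`, r ≤ a and r ≤ d are combined with the weights t
  -- - 1 and 3 - t.
  t≤3 : t ≤ 1# + 1# + 1#
  t≤3 = ≤-respʳ-≈ t²≈3 (x≤tx 0≤t)

  0≤1+t : 0# ≤ t + 1#
  0≤1+t = +-nonNeg 0≤t 0≤1

  x≤[1+t]x : ∀ {x} → 0# ≤ x → x ≤ (t + 1#) * x
  x≤[1+t]x {x} 0≤x = ≤-certificate
    (solve 2 (λ t x → x :+ t :* x := (t :+ con 1) :* x :+ con 0) ≈-refl t x) (*-nonNeg 0≤t 0≤x)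

-- Cost accounting along a run of the algorithm, shared by both bounds.

module Analysis {ℓ} (R : RealField ℓ) (t : RealField.Carrier R)
  (tie : Exploration.TieBreak R) (Γ : Exploration.Cycle R)
  (s : Exploration.Cycle.Vertex Γ) where

  open RealField R
  open Exploration R
  open OrderedField R
  open Cycle Γ
  open CycleWalks R Γ
  open HeavyTest t tie Γ s

  opposite-involutive : ∀ δ → opposite (opposite δ) ≡ δ
  opposite-involutive cw  = ≡.refl
  opposite-involutive ccw = ≡.refl

  -- In the paper's notation, the agent at position δ i sees a = span δ i,
  -- b = boundary δ i and d = span (opposite δ) (suc j).

  span boundary : Dir → ℕ → Carrier
  span     δ i = cost s (replicate i δ)
  boundary δ i = edgeWeight δ (position δ i)

  span-suc : ∀ δ i → span δ (suc i) ≈ span δ i + boundary δ i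
  span-suc δ i = cost-suc s i δ

  span-nonNeg : ∀ δ i → 0# ≤ span δ i
  span-nonNeg δ i = cost-nonNeg s (replicate i δ)

  boundary≤span : ∀ δ i → boundary δ i ≤ span δ (suc i)
  boundary≤span δ i = ≤-respʳ-≈ (≈-sym (span-suc δ i)) (x≤y+x (span-nonNeg δ i))

  cost-backToStart : ∀ δ i → cost (position δ i) (backToStart δ i) ≈ span δ i
  cost-backToStart δ i = cost-retrace s i δ

  Direct : Dir → ℕ → ℕ → Set ℓ
  Direct δ i j = boundary δ i ≤ t * span δ i + span (opposite δ) (suc j)

  threshold : ∀ δ i j → t * span δ i + span (opposite δ) (suc j) ≈
    t * cost (position δ i) (backToStart δ i) + cost s (replicate (suc j) (opposite δ))
  threshold δ i j = +-congʳ (*-congˡ (≈-sym (cost-backToStart δ i)))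

  movesDirectly-true : ∀ δ i j → Direct δ i j → movesDirectly δ i j ≡ true
  movesDirectly-true δ i j direct = dec-true (_ ≤? _) (≤-respʳ-≈ (threshold δ i j) direct)

  movesDirectly-false : ∀ δ i j → ¬ Direct δ i j → movesDirectly δ i j ≡ false
  movesDirectly-false δ i j ¬direct =
    dec-false (_ ≤? _) (λ direct → ¬direct (≤-respʳ-≈ (≈-sym (threshold δ i j)) direct))

  direct? : ∀ δ i j → Direct δ i j ⊎ ¬ Direct δ i j
  direct? δ i j with boundary δ i ≤? (t * span δ i + span (opposite δ) (suc j))
  ... | yes direct = inj₁ direct
  ... | no ¬direct = inj₂ ¬direct

  -- The total cost of the algorithm if, before reaching the current state, it has
  -- paid c in addition to the length of the path from s to the agent.
  account : Carrier → ℕ → Dir → ℕ → ℕ → Carrier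
  account c k δ i j = (c + span δ i) + cost (position δ i) (explore k δ i j)

  -- The weight of the new edge passes from the remaining cost to the span, so the excess `c` stays
  -- the same.
  account-direct : ∀ c k δ i j → Direct δ i j →
    account c (suc k) δ i j ≈ account c k δ (suc i) j
  account-direct c k δ i j direct = begin
    (c + span δ i) + cost v (explore (suc k) δ i j)
      ≡⟨ cong (λ b → (c + span δ i) + cost v (if b then δ ∷ rec else
           backToStart δ i ++ replicate (suc j) (opposite δ) ++ explore k (opposite δ) (suc j) i))
           (movesDirectly-true δ i j direct) ⟩
    (c + span δ i) + (boundary δ i + cost (move δ v) rec)
      ≡⟨ cong (λ u → (c + span δ i) + (boundary δ i + cost u rec)) (endpoint-suc s i) ⟨
    (c + span δ i) + (boundary δ i + cost (position δ (suc i)) rec)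
      ≈⟨ solve 4 (λ c a b r → c :+ a :+ (b :+ r) := c :+ (a :+ b) :+ r) ≈-refl c (span δ i) (boundary δ i) _ ⟩
    (c + (span δ i + boundary δ i)) + cost (position δ (suc i)) rec
      ≈⟨ +-congʳ (+-congˡ (span-suc δ i)) ⟨
    (c + span δ (suc i)) + cost (position δ (suc i)) rec ∎
    where
    open ≈-Reasoning setoid
    v   = position δ i
    rec = explore k δ (suc i) j

  -- The abandoned span has been walked out and is now walked back, and it is not part of the new
  -- path from `s` to the agent; both passages become excess.
  account-backtrack : ∀ c k δ i j → ¬ Direct δ i j →
    account c (suc k) δ i j ≈ account (c + (span δ i + span δ i)) k (opposite δ) (suc j) i
  account-backtrack c k δ i j ¬direct = begin
    (c + span δ i) + cost v (explore (suc k) δ i j)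
      ≡⟨ cong (λ b → (c + span δ i) + cost v (if b then δ ∷ explore k δ (suc i) j else backToStart δ i ++ out ++ rec))
           (movesDirectly-false δ i j ¬direct) ⟩
    (c + span δ i) + cost v (backToStart δ i ++ out ++ rec)
      ≈⟨ +-congˡ (cost-++ v (backToStart δ i)) ⟩
    (c + span δ i) + (cost v (backToStart δ i) + cost (endpoint v (backToStart δ i)) (out ++ rec))
      ≡⟨ cong (λ u → (c + span δ i) + (cost v (backToStart δ i) + cost u (out ++ rec)))
           (endpoint-retrace s i δ) ⟩
    (c + span δ i) + (cost v (backToStart δ i) + cost s (out ++ rec))
      ≈⟨ +-congˡ (+-cong (cost-backToStart δ i) (cost-++ s out)) ⟩
    (c + span δ i) + (span δ i + (span (opposite δ) (suc j) + cost (position (opposite δ) (suc j)) rec))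
      ≈⟨ solve 4 (λ c a d r → c :+ a :+ (a :+ (d :+ r)) := c :+ (a :+ a) :+ d :+ r)
           ≈-refl c (span δ i) (span (opposite δ) (suc j)) _ ⟩
    (c + (span δ i + span δ i) + span (opposite δ) (suc j)) + cost (position (opposite δ) (suc j)) rec ∎
    where
    open ≈-Reasoning setoid
    v   = position δ i
    out = replicate (suc j) (opposite δ)
    rec = explore k (opposite δ) (suc j) i

  -- Another `suc j` steps in direction `δ` complete the round at `s`; undoing them from `s` leads
  -- back to the same vertex.
  position-meet : ∀ δ i j → i ℕ.+ suc j ≡ n → position δ i ≡ position (opposite δ) (suc j)
  position-meet δ i j i+1+j≡n = ≡.trans (≡.sym (endpoint-retrace (position δ i) (suc j) δ))
    (cong (λ u → endpoint u (replicate (suc j) (opposite δ))) (begin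
      endpoint (position δ i) (replicate (suc j) δ)   ≡⟨ endpoint-++ s (replicate i δ) ⟨
      endpoint s (replicate i δ ++ replicate (suc j) δ)
        ≡⟨ cong (endpoint s) (≡.trans (≡.sym (replicate-+ i (suc j))) (cong (λ k → replicate k δ) i+1+j≡n)) ⟩
      endpoint s (replicate n δ)                      ≡⟨ endpoint-n δ s ⟩
      s                                               ∎))
    where open ≡.≡-Reasoning

  edges-onward : ∀ δ i j → i ℕ.+ suc j ≡ n →
    edges (position δ i) (replicate (suc j) δ) ↭ edges s (replicate (suc j) (opposite δ))
  edges-onward δ i j i+1+j≡n = ↭.trans
    (↭.↭-reflexive (≡.cong₂ (λ u γ → edges u (replicate (suc j) γ))
      (position-meet δ i j i+1+j≡n) (≡.sym (opposite-involutive δ))))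
    (edges-retrace s (suc j) (opposite δ))

  cost-onward : ∀ δ i j → i ℕ.+ suc j ≡ n →
    cost (position δ i) (replicate (suc j) δ) ≈ span (opposite δ) (suc j)
  cost-onward δ i j i+1+j≡n = cost-↭ (position δ i) (replicate (suc j) δ) s
    (replicate (suc j) (opposite δ)) (edges-onward δ i j i+1+j≡n)

  length-split : ∀ δ i j → i ℕ.+ suc j ≡ n → length s ≈ span δ i + span (opposite δ) (suc j)
  length-split δ i j i+1+j≡n = begin
    length s                     ≈⟨ cost-n δ s ⟨
    cost s (replicate n δ)       ≡⟨ cong (λ k → cost s (replicate k δ)) i+1+j≡n ⟨
    span δ (i ℕ.+ suc j)         ≡⟨ cong (cost s) (replicate-+ i (suc j)) ⟩
    cost s (replicate i δ ++ replicate (suc j) δ)               ≈⟨ cost-++ s (replicate i δ) ⟩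
    span δ i + cost (position δ i) (replicate (suc j) δ)
      ≈⟨ +-congˡ (cost-onward δ i j i+1+j≡n) ⟩
    span δ i + span (opposite δ) (suc j)                        ∎
    where open ≈-Reasoning setoid

  -- At the end the two arcs from `s` cover the cycle, so the field `light` of the invariant then
  -- speaks of every edge.
  ∈edges-split : ∀ δ i j → i ℕ.+ suc j ≡ n → ∀ u →
    u ∈ edges s (replicate i δ) ⊎ u ∈ edges s (replicate (suc j) (opposite δ))
  ∈edges-split δ i j i+1+j≡n u
    with ∈-++⁻ (edges s (replicate i δ)) (subst (u ∈_) split (∈edges-n δ s u))
    where
    split : edges s (replicate n δ) ≡
      edges s (replicate i δ) ++ edges (position δ i) (replicate (suc j) δ)
    split = ≡.trans (cong (edges s)
      (≡.trans (cong (λ k → replicate k δ) (≡.sym i+1+j≡n)) (replicate-+ i (suc j))))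
      (edges-++ s (replicate i δ))
  ... | inj₁ u∈ = inj₁ u∈
  ... | inj₂ u∈ = inj₂ (↭ₚ.∈-resp-↭ (edges-onward δ i j i+1+j≡n) u∈)

  -- The two inequalities serve the upper bound. The final alternative serves the lower bound, where
  -- both ways home have the same length.
  cost-return : ∀ δ i j → i ℕ.+ suc j ≡ n →
    let r = cost (position δ i) (return δ i j); a = span δ i; d = span (opposite δ) (suc j) in
    r ≤ a × r ≤ d × (r ≈ a ⊎ r ≈ d)
  cost-return δ i j i+1+j≡n = by-cases (_ ≤? _)
    where
    v      = position δ i
    onward = replicate (suc j) δ
    -- With the comparison as a variable, matching on it reduces the `if` inside `return`.
    by-cases : (back? : Dec (cost v (backToStart δ i) ≤ cost v onward)) →
      let r = cost v (if does back? then backToStart δ i else onward) in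
      r ≤ span δ i × r ≤ span (opposite δ) (suc j) × (r ≈ span δ i ⊎ r ≈ span (opposite δ) (suc j))
    by-cases (yes back≤) = ≤-reflexive (cost-backToStart δ i) ,
      ≤-respʳ-≈ (cost-onward δ i j i+1+j≡n) back≤ , inj₁ (cost-backToStart δ i)
    by-cases (no back≰) with total (cost v onward) (cost v (backToStart δ i))
    ... | inj₁ onward≤ = ≤-respʳ-≈ (cost-backToStart δ i) onward≤ ,
      ≤-reflexive (cost-onward δ i j i+1+j≡n) , inj₂ (cost-onward δ i j i+1+j≡n)
    ... | inj₂ back≤   = contradiction back≤ back≰

-- The upper bound, by an invariant of the exploration.

module UpperBound {ℓ} (R : RealField ℓ) (t : RealField.Carrier R)
  (isRoot : IsSquareRootOfThree R t) (tie : Exploration.TieBreak R)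
  (Γ : Exploration.Cycle R) (s : Exploration.Cycle.Vertex Γ) where

  open RealField R
  open Exploration R
  open OrderedField R
  open SquareRootOfThree R t isRoot
  open Cycle Γ
  open CycleWalks R Γ
  open HeavyTest t tie Γ s
  open Analysis R t tie Γ s

  -- c is twice the total length of the abandoned spans.
  record Invariant (c : Carrier) (δ ε : Dir) (i j : ℕ) : Set ℓ where
    constructor invariant
    field
      c+d≤td    : c + span ε (suc j) ≤ t * span ε (suc j)
      c+a≤2b+ta : c + span δ i ≤ (span ε j + span ε j) + t * span δ i
      light     : ∀ u → u ∈ edges s (replicate i δ) ⊎ u ∈ edges s (replicate (suc j) ε) →
                  weight u ≤ boundary ε j ⊎
                  (t + 1#) * weight u ≤ t * span δ i + span ε (suc j)

  ∈edges-suc : ∀ δ i {u} → u ∈ edges s (replicate (suc i) δ) →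
    u ∈ edges s (replicate i δ) ⊎ weight u ≡ boundary δ i
  ∈edges-suc δ i {u} u∈ with ∈-++⁻ (edges s (replicate i δ)) (subst (u ∈_)
      (≡.trans (cong (edges s) (replicate-∷ʳ i)) (edges-++ s (replicate i δ))) u∈)
  ... | inj₁ u∈i          = inj₁ u∈i
  ... | inj₂ (here ≡.refl) = inj₂ (≡.sym (edgeWeight≡ δ (position δ i)))

  invariant-direct : ∀ {c δ i j} → Direct δ i j →
    Invariant c δ (opposite δ) i j → Invariant c δ (opposite δ) (suc i) j
  invariant-direct {c} {δ} {i} {j} direct (invariant c+d≤td c+a≤2b+ta light) =
    invariant c+d≤td c+a≤2b+ta′ light′
    where
    a  = span δ i
    b  = boundary δ i
    a⁻ = span (opposite δ) j
    d  = span (opposite δ) (suc j)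
    0≤b : 0# ≤ b
    0≤b = edgeWeight-nonNeg δ (position δ i)
    ta≤ta′ : t * a ≤ t * span δ (suc i)
    ta≤ta′ = *-monoˡ-≤ t 0≤t (≤-respʳ-≈ (≈-sym (span-suc δ i)) (x≤x+y 0≤b))
    c+a≤2b+ta′ : c + span δ (suc i) ≤ (a⁻ + a⁻) + t * span δ (suc i)
    c+a≤2b+ta′ = ≤-respˡ-≈ (+-congˡ (≈-sym (span-suc δ i)))
      (≤-respʳ-≈ (+-congˡ (*-congˡ (≈-sym (span-suc δ i))))
        (≤-certificate
          (solve 5 (λ t c a b z → c :+ (a :+ b) :+ (z :+ z :+ t :* a :+ t :* b) :=
              z :+ z :+ t :* (a :+ b) :+ (c :+ a :+ b))
            ≈-refl t c a b a⁻)
          (+-mono-≤ c+a≤2b+ta (x≤tx 0≤b))))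
    -- Adding t b to both sides of b ≤ t a + d gives the second alternative of `light` for the new
    -- edge.
    [1+t]b≤ : (t + 1#) * b ≤ t * span δ (suc i) + d
    [1+t]b≤ = ≤-respʳ-≈ (+-congʳ (*-congˡ (≈-sym (span-suc δ i))))
      (≤-certificate
        (solve 4 (λ t a b d → (t :+ con 1) :* b :+ (t :* a :+ d) := t :* (a :+ b) :+ d :+ b)
          ≈-refl t a b d)
        direct)
    explored : ∀ u → weight u ≤ boundary (opposite δ) j ⊎ (t + 1#) * weight u ≤ t * a + d →
      weight u ≤ boundary (opposite δ) j ⊎ (t + 1#) * weight u ≤ t * span δ (suc i) + d
    explored u (inj₁ w≤) = inj₁ w≤
    explored u (inj₂ w≤) = inj₂ (≤-trans w≤ (+-mono-≤ ta≤ta′ ≤-refl))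
    light′ : ∀ u →
      u ∈ edges s (replicate (suc i) δ) ⊎ u ∈ edges s (replicate (suc j) (opposite δ)) →
      weight u ≤ boundary (opposite δ) j ⊎ (t + 1#) * weight u ≤ t * span δ (suc i) + d
    light′ u (inj₂ u∈) = explored u (light u (inj₂ u∈))
    light′ u (inj₁ u∈) with ∈edges-suc δ i u∈
    ... | inj₁ u∈i = explored u (light u (inj₁ u∈i))
    ... | inj₂ w≡b = inj₂ (subst (λ w → (t + 1#) * w ≤ t * span δ (suc i) + d) (≡.sym w≡b) [1+t]b≤)

  -- An edge that is too heavy for a direct move is heavier than everything explored.
  invariant-backtrack : ∀ {c δ i j} → ¬ Direct δ i j →
    Invariant c δ (opposite δ) i j →
    Invariant (c + (span δ i + span δ i)) (opposite δ) δ (suc j) i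
  invariant-backtrack {c} {δ} {i} {j} ¬direct (invariant c+d≤td c+a≤2b+ta light) =
    invariant c+d≤td′ c+a≤2b+ta′ (λ u u∈ → inj₁ (light′ u u∈))
    where
    a = span δ i
    b = boundary δ i
    d = span (opposite δ) (suc j)
    ta+d≤b : t * a + d ≤ b
    ta+d≤b with total b (t * a + d)
    ... | inj₁ direct = contradiction direct ¬direct
    ... | inj₂ h      = h
    0≤ta : 0# ≤ t * a
    0≤ta = *-nonNeg 0≤t (span-nonNeg δ i)
    -- The claim reads c ≤ (t - 3) a + (t - 1) b. From b ≥ t a + d and t² = 3 it follows that (t -
    -- 1) b ≥ (3 - t) a + (t - 1) d. The terms in a cancel exactly, and c ≤ (t - 1) d remains.
    c+d≤td′ : c + (a + a) + span δ (suc i) ≤ t * span δ (suc i)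
    c+d≤td′ = ≤-respˡ-≈ (+-congˡ (≈-sym (span-suc δ i)))
      (≤-respʳ-≈ (*-congˡ (≈-sym (span-suc δ i)))
        (≤-certificate
          (solve 5 (λ t c a b d →
              c :+ (a :+ a) :+ (a :+ b) :+
                (t :* d :+ (t :* b :+ con 1 :* (t :* a :+ d)) :+ t :* t :* a)
              := t :* (a :+ b) :+
                (c :+ d :+ (t :* (t :* a :+ d) :+ con 1 :* b) :+ (con 1 :+ con 1 :+ con 1) :* a))
            ≈-refl t c a b d)
          (+-mono-≤ (+-mono-≤ c+d≤td (rearrangement 1≤t ta+d≤b))
            (≤-reflexive (*-congʳ (≈-sym t²≈3))))))
    -- The sides have swapped: 2 a is twice the span just abandoned, and the rest is the old bound c
    -- + d ≤ t d.
    c+a≤2b+ta′ : c + (a + a) + d ≤ (a + a) + t * d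
    c+a≤2b+ta′ = ≤-certificate
      (solve 4 (λ t c a d → c :+ (a :+ a) :+ d :+ t :* d := a :+ a :+ t :* d :+ (c :+ d))
        ≈-refl t c a d)
      c+d≤td
    explored : ∀ u → weight u ≤ boundary (opposite δ) j ⊎ (t + 1#) * weight u ≤ t * a + d →
      weight u ≤ b
    explored u (inj₁ w≤) =
      ≤-trans w≤ (≤-trans (boundary≤span (opposite δ) j) (≤-trans (x≤y+x 0≤ta) ta+d≤b))
    explored u (inj₂ w≤) = ≤-trans (x≤[1+t]x (weight-nonNeg u)) (≤-trans w≤ ta+d≤b)
    light′ : ∀ u →
      u ∈ edges s (replicate (suc j) (opposite δ)) ⊎ u ∈ edges s (replicate (suc i) δ) →
      weight u ≤ b
    light′ u (inj₁ u∈) = explored u (light u (inj₂ u∈))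
    light′ u (inj₂ u∈) with ∈edges-suc δ i u∈
    ... | inj₁ u∈i = explored u (light u (inj₁ u∈i))
    ... | inj₂ w≡b = ≤-reflexive (≈-reflexive w≡b)

  -- With ρ = (t + 1)/2 and W the length of the cycle, these are x ≤ ρ W and x ≤ 2 ρ (W - w) for
  -- every edge weight w, cleared of division and subtraction.
  Bounded : Carrier → Set ℓ
  Bounded x = x + x ≤ (t + 1#) * length s ×
    ∀ u → x + (t + 1#) * weight u ≤ (t + 1#) * length s

  Bounded-resp-≈ : ∀ {x y} → x ≈ y → Bounded x → Bounded y
  Bounded-resp-≈ x≈y (round , double) =
    ≤-respˡ-≈ (+-cong x≈y x≈y) round , λ u → ≤-respˡ-≈ (+-congʳ x≈y) (double u)

  account-return : ∀ c δ i j → i ℕ.+ suc j ≡ n → Invariant c δ (opposite δ) i j →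
    Bounded (account c 0 δ i j)
  account-return c δ i j i+1+j≡n (invariant c+d≤td c+a≤2b+ta light)
    with cost-return δ i j i+1+j≡n
  ... | r≤a , r≤d , _ =
    ≤-respʳ-≈ length-eq round , λ u → ≤-respʳ-≈ length-eq (double u (light u (∈edges-split δ i j i+1+j≡n u)))
    where
    ε  = opposite δ
    a  = span δ i
    a⁻ = span ε j
    b⁻ = boundary ε j
    d  = span ε (suc j)
    r  = cost (position δ i) (return δ i j)
    length-eq : (t + 1#) * (a + d) ≈ (t + 1#) * length s
    length-eq = *-congˡ (≈-sym (length-split δ i j i+1+j≡n))
    -- 2 r is at most (t - 1) a + (3 - t) d.
    round : (c + a + r) + (c + a + r) ≤ (t + 1#) * (a + d)
    round = ≤-certificate
      (solve 5 (λ t c a d r →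
          c :+ a :+ r :+ (c :+ a :+ r) :+
            (t :* d :+ t :* d :+ (t :* a :+ con 1 :* r)
              :+ ((con 1 :+ con 1 :+ con 1) :* d :+ t :* r))
          := (t :+ con 1) :* (a :+ d) :+
            (c :+ d :+ (c :+ d) :+ (t :* r :+ con 1 :* a)
              :+ ((con 1 :+ con 1 :+ con 1) :* r :+ t :* d)))
        ≈-refl t c a d r)
      (+-mono-≤ (+-mono-≤ (+-mono-≤ c+d≤td c+d≤td) (rearrangement 1≤t r≤a)) (rearrangement t≤3 r≤d))
    double : ∀ u → weight u ≤ b⁻ ⊎ (t + 1#) * weight u ≤ t * a + d →
      (c + a + r) + (t + 1#) * weight u ≤ (t + 1#) * (a + d)
    -- From r ≤ a and c + a ≤ 2 a⁻ + t a, the cost is at most (t + 1) a + 2 a⁻, and 2 ≤ t + 1. The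
    -- edge itself is paid for by b⁻, where d = a⁻ + b⁻.
    double u (inj₁ w≤b⁻) = ≤-respʳ-≈ (*-congˡ (+-congˡ (≈-sym (span-suc ε j))))
      (≤-certificate
        (solve 7 (λ t c a z b r w →
            c :+ a :+ r :+ (t :+ con 1) :* w :+
              (a :+ (z :+ z :+ t :* a) :+ (t :+ con 1) :* b :+ t :* z)
            := (t :+ con 1) :* (a :+ (z :+ b)) :+ (r :+ (c :+ a) :+ (t :+ con 1) :* w :+ z))
          ≈-refl t c a a⁻ b⁻ r (weight u))
        (+-mono-≤ (+-mono-≤ (+-mono-≤ r≤a c+a≤2b+ta) (*-monoˡ-≤ (t + 1#) 0≤1+t w≤b⁻))
          (x≤tx (span-nonNeg ε j))))
    -- Here r ≤ d is the useful estimate: a and the bounds (t - 1) d, d and t a + d add up to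
    -- exactly (t + 1) (a + d).
    double u (inj₂ w≤) = ≤-certificate
      (solve 6 (λ t c a d r w →
          c :+ a :+ r :+ (t :+ con 1) :* w :+ (t :* d :+ d :+ (t :* a :+ d))
          := (t :+ con 1) :* (a :+ d) :+ (c :+ d :+ r :+ (t :+ con 1) :* w))
        ≈-refl t c a d r (weight u))
      (+-mono-≤ (+-mono-≤ c+d≤td r≤d) w≤)

  -- The invariant is carried forward to the last vertex; the bound obtained there travels back,
  -- since no step changes the account.
  account-bounded : ∀ k c δ i j → k ℕ.+ (i ℕ.+ suc j) ≡ n → Invariant c δ (opposite δ) i j →
    Bounded (account c k δ i j)
  account-bounded zero    c δ i j i+1+j≡n inv = account-return c δ i j i+1+j≡n inv
  account-bounded (suc k) c δ i j k+i+j≡n inv with direct? δ i j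
  ... | inj₁ direct = Bounded-resp-≈ (≈-sym (account-direct c k δ i j direct))
    (account-bounded k c δ (suc i) j
      (≡.trans (ℕₚ.+-suc k (i ℕ.+ suc j)) k+i+j≡n) (invariant-direct direct inv))
  ... | inj₂ ¬direct = Bounded-resp-≈ (≈-sym (account-backtrack c k δ i j ¬direct))
    (account-bounded k (c + (span δ i + span δ i)) (opposite δ) (suc j) i
      (≡.trans (cong (k ℕ.+_) (ℕₚ.+-comm (suc j) (suc i)))
        (≡.trans (ℕₚ.+-suc k (i ℕ.+ suc j)) k+i+j≡n))
      (subst (λ ε → Invariant (c + (span δ i + span δ i)) (opposite δ) ε (suc j) i) (≡.sym (opposite-involutive δ))
        (invariant-backtrack ¬direct inv)))

  firstDir-lighter : edgeWeight firstDir s ≤ edgeWeight (opposite firstDir) s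
  firstDir-lighter = by-cases (edgeWeight cw s ≟ edgeWeight ccw s) (edgeWeight cw s ≤? edgeWeight ccw s) _
    where
    by-cases : (eq? : Dec (edgeWeight cw s ≈ edgeWeight ccw s))
      (le? : Dec (edgeWeight cw s ≤ edgeWeight ccw s)) (tied : Dir) →
      let δ = if does eq? then tied else if does le? then cw else ccw in
      edgeWeight δ s ≤ edgeWeight (opposite δ) s
    by-cases (yes eq) _        cw   = ≤-reflexive eq
    by-cases (yes eq) _        ccw  = ≤-reflexive (≈-sym eq)
    by-cases (no _)   (yes le) _    = le
    by-cases (no _)   (no ¬le) _    with total (edgeWeight cw s) (edgeWeight ccw s)
    ... | inj₁ le = contradiction le ¬le
    ... | inj₂ ge = ge

  -- The first edge is no heavier than the other edge at `s`, which is then the boundary edge of the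
  -- other side. This is where the upper bound uses the rule for the first step.
  invariant-initial : ∀ {δ} → edgeWeight δ s ≤ edgeWeight (opposite δ) s →
    Invariant 0# δ (opposite δ) 1 0
  invariant-initial {δ} lighter = invariant
    (≤-respˡ-≈ (≈-sym (+-identityˡ _)) (x≤tx (span-nonNeg (opposite δ) 1)))
    (≤-respˡ-≈ (≈-sym (+-identityˡ _))
      (≤-respʳ-≈ (≈-sym (≈-trans (+-congʳ (+-identityˡ 0#)) (+-identityˡ _)))
        (x≤tx (span-nonNeg δ 1))))
    λ { u (inj₁ (here ≡.refl)) → inj₁ (≤-respˡ-≈ (≈-reflexive (edgeWeight≡ δ s)) lighter)
      ; u (inj₂ (here ≡.refl)) → inj₁ (≤-reflexive (≈-reflexive (≡.sym (edgeWeight≡ (opposite δ) s)))) }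

  cost-tour : cost s tour ≈ account 0# (1 ℕ.+ extra) firstDir 1 0
  cost-tour = solve 2 (λ w r → w :+ r := con 0 :+ (w :+ con 0) :+ r) ≈-refl _ _

  tour-bounded : Bounded (cost s tour)
  tour-bounded = Bounded-resp-≈ (≈-sym cost-tour)
    (account-bounded (1 ℕ.+ extra) 0# firstDir 1 0 (cong suc (ℕₚ.+-comm extra 2))
      (invariant-initial firstDir-lighter))

  heavyTest≤ : ∀ {ρ o} → ρ + ρ ≈ t + 1# →
    (o ≈ length s ⊎ ∃ λ e → o ≈ Cut.rest e + Cut.rest e) → cost s tour ≤ ρ * o
  heavyTest≤ {ρ} {o} ρ+ρ≈t+1 (inj₁ o≈length) = ≤-respʳ-≈ (*-congˡ (≈-sym o≈length))
    (x+x≤y+y⇒x≤y (≤-respʳ-≈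
      (≈-trans (*-congʳ (≈-sym ρ+ρ≈t+1)) (distribʳ (length s) ρ ρ)) (proj₁ tour-bounded)))
  heavyTest≤ {ρ} {o} ρ+ρ≈t+1 (inj₂ (e , o≈2rest)) = ≤-respʳ-≈
    (≈-trans (*-congʳ (≈-sym ρ+ρ≈t+1))
      (≈-trans (solve 2 (λ ρ r → (ρ :+ ρ) :* r := ρ :* (r :+ r)) ≈-refl ρ rest)
        (*-congˡ (≈-sym o≈2rest))))
    (+-cancelʳ-≤ ((t + 1#) * weight e) (≤-respʳ-≈
      (≈-trans (*-congˡ (≈-trans (Cut.length≈weight+rest e s) (+-comm (weight e) rest)))
        (distribˡ (t + 1#) rest (weight e)))
      (proj₂ tour-bounded e)))
    where
    rest = Cut.rest e

-- For x = extra, the cycle has clockwise from s the weights 1, ..., 1 (x times),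
-- b, y and 2.  The agent makes x direct moves, just refuses b, and ends at the
-- point opposite to s, at distance x + b = y + 2 in both directions.

module LowerBound {ℓ} (R : RealField ℓ) (t : RealField.Carrier R)
  (isRoot : IsSquareRootOfThree R t) (tie : Exploration.TieBreak R) where

  open RealField R
  open Exploration R
  open OrderedField R
  open SquareRootOfThree R t isRoot

  profile : Carrier → Carrier → ℕ → ℕ → Carrier
  profile b y zero    zero          = b
  profile b y zero    (suc zero)    = y
  profile b y zero    (suc (suc _)) = 2#
  profile b y (suc x) zero          = 1#
  profile b y (suc x) (suc q)       = profile b y x q

  module _ {b y : Carrier} where

    profile-< : ∀ {x q} → q ℕ.< x → profile b y x q ≡ 1#
    profile-< {suc x} {zero}  _         = ≡.refl
    profile-< {suc x} {suc q} (s≤s q<x) = profile-< q<x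

    profile-x : ∀ x → profile b y x x ≡ b
    profile-x zero    = ≡.refl
    profile-x (suc x) = profile-x x

    profile-1+x : ∀ x → profile b y x (1 ℕ.+ x) ≡ y
    profile-1+x zero    = ≡.refl
    profile-1+x (suc x) = profile-1+x x

    profile-2+x : ∀ x → profile b y x (2 ℕ.+ x) ≡ 2#
    profile-2+x zero    = ≡.refl
    profile-2+x (suc x) = profile-2+x x

    profile-nonNeg : 0# ≤ b → 0# ≤ y → ∀ x q → 0# ≤ profile b y x q
    profile-nonNeg 0≤b 0≤y zero    zero          = 0≤b
    profile-nonNeg 0≤b 0≤y zero    (suc zero)    = 0≤y
    profile-nonNeg 0≤b 0≤y zero    (suc (suc _)) = +-nonNeg 0≤1 0≤1
    profile-nonNeg 0≤b 0≤y (suc x) zero          = 0≤1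
    profile-nonNeg 0≤b 0≤y (suc x) (suc q)       = profile-nonNeg 0≤b 0≤y x q

  ·1-nonNeg : ∀ k → 0# ≤ k · 1#
  ·1-nonNeg zero    = ≤-refl
  ·1-nonNeg (suc k) = +-nonNeg 0≤1 (·1-nonNeg k)

  ·≈* : ∀ k g → k · g ≈ g * (k · 1#)
  ·≈* zero    g = ≈-sym (zeroʳ g)
  ·≈* (suc k) g = ≈-trans (+-congˡ (·≈* k g))
    (solve 2 (λ g m → g :+ g :* m := g :* (con 1 :+ m)) ≈-refl g (k · 1#))

  module _ (m : ℕ) where

    -- At least one unit edge is needed, so that the first clockwise edge is lighter than the
    -- counterclockwise edge of weight 2.
    x : ℕ
    x = suc m

    -- The weight `heavy` exceeds the threshold t x + 2 by 1, and `penultimate` is chosen so that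
    -- both arcs from `s` to the last vertex have length `radius`.
    heavy penultimate radius : Carrier
    heavy       = t * (x · 1#) + (2# + 1#)
    penultimate = t * (x · 1#) + (x · 1# + 1#)
    radius      = (t + 1#) * (x · 1#) + (2# + 1#)

    0≤tx : 0# ≤ t * (x · 1#)
    0≤tx = *-nonNeg 0≤t (·1-nonNeg x)

    Γ : Cycle
    Γ = record
      { extra                = x
      ; identifier           = toℕ
      ; identifier-injective = toℕ-injective
      ; weight               = λ v → profile heavy penultimate x (toℕ v)
      ; weight-nonNeg        = λ v → profile-nonNeg
          (+-nonNeg 0≤tx (+-nonNeg (+-nonNeg 0≤1 0≤1) 0≤1))
          (+-nonNeg 0≤tx (+-nonNeg (·1-nonNeg x) 0≤1)) x (toℕ v)
      }

    s : Cycle.Vertex Γ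
    s = Fin.zero

    open Cycle Γ
    open CycleWalks R Γ
    open HeavyTest t tie Γ s
    open Analysis R t tie Γ s

    boundary-cw : ∀ {q} → q ℕ.< n → boundary cw q ≡ profile heavy penultimate x q
    boundary-cw {q} q<n = cong (profile heavy penultimate x)
      (≡.trans (toℕ-endpoint-cw q s) (m<n⇒m%n≡m q<n))

    toℕ-position-ccw-1 : toℕ (position ccw 1) ≡ 2 ℕ.+ x
    toℕ-position-ccw-1 = ≡.trans (toℕ-move-ccw s) (m<n⇒m%n≡m ℕₚ.≤-refl)

    boundary-ccw-0 : boundary ccw 0 ≡ 2#
    boundary-ccw-0 = ≡.trans (cong (profile heavy penultimate x) toℕ-position-ccw-1) (profile-2+x x)

    boundary-ccw-1 : boundary ccw 1 ≡ penultimate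
    boundary-ccw-1 = ≡.trans (cong (profile heavy penultimate x) (begin
      toℕ (move ccw (position ccw 1))                ≡⟨ toℕ-move-ccw (position ccw 1) ⟩
      (toℕ (position ccw 1) ℕ.+ (2 ℕ.+ x)) % n
        ≡⟨ cong (λ z → (z ℕ.+ (2 ℕ.+ x)) % n) toℕ-position-ccw-1 ⟩
      (2 ℕ.+ x ℕ.+ (2 ℕ.+ x)) % n                    ≡⟨ cong (_% n) (ℕₚ.+-suc (1 ℕ.+ x) (2 ℕ.+ x)) ⟨
      (1 ℕ.+ x ℕ.+ n) % n                            ≡⟨ [m+n]%n≡m%n (1 ℕ.+ x) n ⟩
      (1 ℕ.+ x) % n                                  ≡⟨ m<n⇒m%n≡m (ℕₚ.n≤1+n (2 ℕ.+ x)) ⟩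
      1 ℕ.+ x                                        ∎)) (profile-1+x x)
      where open ≡.≡-Reasoning

    span-cw : ∀ {i} → i ℕ.≤ x → span cw i ≈ i · 1#
    span-cw {zero}  _   = ≈-refl
    span-cw {suc i} i<x = ≈-trans (span-suc cw i) (≈-trans (+-comm _ _)
      (+-cong (≈-reflexive (≡.trans (boundary-cw (ℕₚ.m≤n⇒m≤o+n 3 i<x)) (profile-< i<x)))
        (span-cw (ℕₚ.<⇒≤ i<x))))

    boundary-x : boundary cw x ≡ heavy
    boundary-x = ≡.trans (boundary-cw (ℕₚ.m≤n+m (suc x) 2)) (profile-x x)

    span-cw-1+x : span cw (suc x) ≈ radius
    span-cw-1+x = ≈-trans (span-suc cw x) (≈-trans
      (+-cong (span-cw ℕₚ.≤-refl) (≈-reflexive boundary-x))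
      (solve 2 (λ t k → k :+ (t :* k :+ (con 1 :+ con 1 :+ con 1)) :=
        (t :+ con 1) :* k :+ (con 1 :+ con 1 :+ con 1)) ≈-refl t (x · 1#)))

    span-ccw-1 : span ccw 1 ≈ 2#
    span-ccw-1 = ≈-trans (+-identityʳ _) (≈-reflexive boundary-ccw-0)

    span-ccw-2 : span ccw 2 ≈ radius
    span-ccw-2 = ≈-trans (span-suc ccw 1) (≈-trans
      (+-cong span-ccw-1 (≈-reflexive boundary-ccw-1))
      (solve 2 (λ t k → con 1 :+ con 1 :+ (t :* k :+ (k :+ con 1)) :=
        (t :+ con 1) :* k :+ (con 1 :+ con 1 :+ con 1)) ≈-refl t (x · 1#)))

    length≈ : length s ≈ radius + radius
    length≈ = ≈-trans (length-split ccw 2 x ≡.refl) (+-cong span-ccw-2 span-cw-1+x)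

    firstDir≡cw : firstDir ≡ cw
    firstDir≡cw = ≡.trans
      (cong (λ b → if b then tied else if does (edgeWeight cw s ≤? edgeWeight ccw s) then cw else ccw)
        (dec-false (edgeWeight cw s ≟ edgeWeight ccw s) 1≉2))
      (cong (λ b → if b then cw else ccw)
        (dec-true (edgeWeight cw s ≤? edgeWeight ccw s) 1≤2))
      where
      tied : Dir
      tied = tie (identifier s) (identifier (move cw s)) (identifier (move ccw s)) (edgeWeight cw s)
      1≤2 : 1# ≤ edgeWeight ccw s
      1≤2 = subst (1# ≤_) (≡.sym boundary-ccw-0) (x≤x+y 0≤1)
      1≉2 : ¬ 1# ≈ edgeWeight ccw s
      1≉2 1≈2 = 1≰0 (≤-certificate
        (solve 0 (con 1 :+ con 1 := con 0 :+ (con 1 :+ con 1)) ≈-refl)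
        (≤-reflexive (≈-sym (≈-trans 1≈2 (≈-reflexive boundary-ccw-0)))))

    direct-phase : ∀ k i → i ℕ.+ k ≡ x →
      account 0# (2 ℕ.+ k) cw i 0 ≈ account 0# 2 cw x 0
    direct-phase zero    i i≡x = ≈-reflexive
      (cong (λ i → account 0# 2 cw i 0) (≡.trans (≡.sym (ℕₚ.+-identityʳ i)) i≡x))
    direct-phase (suc k) i i+k≡x = ≈-trans (account-direct 0# (2 ℕ.+ k) cw i 0 direct)
      (direct-phase k (suc i) 1+i+k≡x)
      where
      1+i+k≡x : suc (i ℕ.+ k) ≡ x
      1+i+k≡x = ≡.trans (≡.sym (ℕₚ.+-suc i k)) i+k≡x
      i<x : i ℕ.< x
      i<x = subst (suc i ℕ.≤_) 1+i+k≡x (s≤s (ℕₚ.m≤m+n i k))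
      -- The edge of weight 2 on the other side alone outweighs the unit edge.
      direct : Direct cw i 0
      direct = ≤-respˡ-≈
        (≈-reflexive (≡.sym (≡.trans (boundary-cw (ℕₚ.m≤n⇒m≤o+n 3 i<x)) (profile-< i<x))))
        (≤-trans (x≤x+y 0≤1) (≤-trans (≤-reflexive (≈-sym span-ccw-1))
          (x≤y+x (*-nonNeg 0≤t (span-nonNeg cw i)))))

    refuses-heavy : ¬ Direct cw x 0
    refuses-heavy direct = 1≰0 (≤-certificate
      (solve 2 (λ t k → con 1 :+ (t :* k :+ (con 1 :+ con 1)) :=
        con 0 :+ (t :* k :+ (con 1 :+ con 1 :+ con 1))) ≈-refl t (x · 1#))
      (≤-respˡ-≈ (≈-reflexive boundary-x)
        (≤-respʳ-≈ (+-cong (*-congˡ (span-cw ℕₚ.≤-refl)) span-ccw-1) direct)))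

    -- The other side with its boundary edge now has length `radius`, which is `penultimate` plus 2.
    accepts-penultimate : Direct ccw 1 x
    accepts-penultimate = ≤-respˡ-≈ (≈-reflexive (≡.sym boundary-ccw-1))
      (≤-trans (≤-trans (x≤x+y (+-nonNeg 0≤1 0≤1))
          (≤-reflexive (≈-sym (≈-trans span-cw-1+x
            (solve 2 (λ t k → (t :+ con 1) :* k :+ (con 1 :+ con 1 :+ con 1) :=
              t :* k :+ (k :+ con 1) :+ (con 1 :+ con 1)) ≈-refl t (x · 1#))))))
        (x≤y+x (*-nonNeg 0≤t (span-nonNeg ccw 1))))

    cost-return≈radius : cost (position ccw 2) (return ccw 2 x) ≈ radius
    cost-return≈radius with proj₂ (proj₂ (cost-return ccw 2 x ≡.refl))
    ... | inj₁ r≈ = ≈-trans r≈ span-ccw-2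
    ... | inj₂ r≈ = ≈-trans r≈ span-cw-1+x

    heavyTest≈ : heavyTest t tie Γ s ≈ (x · 1# + x · 1#) + (radius + radius)
    heavyTest≈ = begin
      cost s (firstDir ∷ explore (1 ℕ.+ x) firstDir 1 0)
        ≡⟨ cong (λ δ → cost s (δ ∷ explore (1 ℕ.+ x) δ 1 0)) firstDir≡cw ⟩
      cost s (cw ∷ explore (1 ℕ.+ x) cw 1 0)
        ≈⟨ solve 2 (λ w r → w :+ r := con 0 :+ (w :+ con 0) :+ r) ≈-refl _ _ ⟩
      account 0# (2 ℕ.+ m) cw 1 0
        ≈⟨ direct-phase m 1 ≡.refl ⟩
      account 0# 2 cw x 0
        ≈⟨ account-backtrack 0# 1 cw x 0 refuses-heavy ⟩
      account (0# + (span cw x + span cw x)) 1 ccw 1 x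
        ≈⟨ account-direct _ 0 ccw 1 x accepts-penultimate ⟩
      0# + (span cw x + span cw x) + span ccw 2 + cost (position ccw 2) (return ccw 2 x)
        ≈⟨ +-cong (+-cong (≈-trans (+-identityˡ _) (+-cong (span-cw ℕₚ.≤-refl) (span-cw ℕₚ.≤-refl)))
             span-ccw-2) cost-return≈radius ⟩
      x · 1# + x · 1# + radius + radius
        ≈⟨ +-assoc _ _ _ ⟩
      (x · 1# + x · 1#) + (radius + radius) ∎
      where open ≈-Reasoning setoid

    0≤radius : 0# ≤ radius
    0≤radius = ≤-respʳ-≈ span-cw-1+x (span-nonNeg cw (suc x))

    1≤heavyTest : 1# ≤ heavyTest t tie Γ s
    1≤heavyTest = ≤-trans (≤-trans (x≤x+y (·1-nonNeg m)) (x≤x+y (·1-nonNeg x)))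
      (≤-respʳ-≈ (≈-sym heavyTest≈) (x≤x+y (+-nonNeg 0≤radius 0≤radius)))

    -- The optimum is at most the length of the cycle, which may replace it when ρ ≥ 0. If ρ ≤ 0,
    -- the cost would be at most 0, although it is at least 1.
    competitive-bound : ∀ {ρ} → Competitive (heavyTest t tie) ρ →
      (x · 1# + x · 1#) + (radius + radius) ≤ ρ * (radius + radius)
    competitive-bound {ρ} competitive = by-sign (total 0# ρ)
      where
      o : Carrier
      o = proj₁ (competitive Γ s)
      isOpt : IsOpt o
      isOpt = proj₁ (proj₂ (competitive Γ s))
      alg≤ρo : heavyTest t tie Γ s ≤ ρ * o
      alg≤ρo = proj₂ (proj₂ (competitive Γ s))
      0≤o : 0# ≤ o
      0≤o = let (v , p , _ , cost≈o) = proj₁ isOpt in ≤-respʳ-≈ cost≈o (cost-nonNeg v p)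
      o≤ : o ≤ radius + radius
      o≤ = ≤-respʳ-≈ length≈ (proj₂ isOpt s (replicate n cw) (roundTour-isTour s))
      by-sign : 0# ≤ ρ ⊎ ρ ≤ 0# → _
      by-sign (inj₁ 0≤ρ) = ≤-respˡ-≈ heavyTest≈ (≤-trans alg≤ρo (*-monoˡ-≤ ρ 0≤ρ o≤))
      by-sign (inj₂ ρ≤0) = contradiction (≤-trans 1≤heavyTest (≤-trans alg≤ρo ρo≤0)) 1≰0
        where
        ρo≤0 : ρ * o ≤ 0#
        ρo≤0 = ≤-certificate
          (solve 2 (λ ρ o → ρ :* o :+ (con 0 :* o :+ ρ :* con 0) :=
            con 0 :+ (con 0 :* con 0 :+ ρ :* o)) ≈-refl ρ o)
          (rearrangement ρ≤0 0≤o)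

  -- The cycles only approach the ratio, so the gap g = ρ₀ - ρ is shown to have bounded multiples;
  -- then g ≤ 0 because the field is Archimedean.
  competitive⇒≥ : ∀ {ρ₀ ρ} → ρ₀ + ρ₀ ≈ t + 1# → Competitive (heavyTest t tie) ρ → ρ₀ ≤ ρ
  competitive⇒≥ {ρ₀} {ρ} 2ρ₀≈ competitive with total ρ₀ ρ
  ... | inj₁ ρ₀≤ρ = ρ₀≤ρ
  ... | inj₂ ρ≤ρ₀ = ≤-certificate (≈-trans (+-identityʳ ρ₀) (≈-sym ρ+g≈ρ₀)) (archimedean bounded)
    where
    g : Carrier
    g = ρ₀ + (- ρ)
    0≤g : 0# ≤ g
    0≤g = x≤y⇒0≤y-x ρ≤ρ₀
    ρ+g≈ρ₀ : ρ + g ≈ ρ₀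
    ρ+g≈ρ₀ = ≈-trans (+-comm ρ g)
      (≈-trans (+-assoc ρ₀ (- ρ) ρ) (≈-trans (+-congˡ (-‿inverseˡ ρ)) (+-identityʳ ρ₀)))
    2[ρ+g]≈ : (ρ + g) + (ρ + g) ≈ t + 1#
    2[ρ+g]≈ = ≈-trans (+-cong ρ+g≈ρ₀ ρ+g≈ρ₀) 2ρ₀≈
    bounded : ∀ k → k · g ≤ (2# + 1#) * t
    bounded zero    = *-nonNeg (+-nonNeg (+-nonNeg 0≤1 0≤1) 0≤1) 0≤t
    -- With r = (t + 1) k + 3, the bound 2 k + 2 r ≤ 2 ρ r and 2 (ρ + g) = t + 1 give 2 g r ≤ (t -
    -- 1) r - 2 k = 3 (t - 1), by t² = 3. The left side contains g k; all that is dropped is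
    -- collected in `slack`.
    bounded (suc m) = ≤-respˡ-≈ (≈-sym (·≈* (suc m) g)) (≤-certificate
      (solve 4 (λ t k ρ g →
          let r = (t :+ con 1) :* k :+ (con 1 :+ con 1 :+ con 1)
              slack = con 1 :+ con 1 :+ con 1 :+ (g :* t :* k :+ g :* t :* k)
                :+ g :* k :+ (con 1 :+ con 1 :+ con 1) :* (g :+ g)
          in g :* k :+ (ρ :* (r :+ r) :+ (t :+ con 1) :* r :+ (con 1 :+ con 1 :+ con 1) :* k :+ slack)
          := (con 1 :+ con 1 :+ con 1) :* t :+
            (k :+ k :+ (r :+ r) :+ (ρ :+ g :+ (ρ :+ g)) :* r :+ t :* t :* k :+ con 0))
        ≈-refl t k ρ g)
      (+-mono-≤ (+-mono-≤ (+-mono-≤ (competitive-bound m competitive)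
        (≤-reflexive (*-congʳ 2[ρ+g]≈))) (≤-reflexive (*-congʳ t²≈3))) 0≤slack))
      where
      k : Carrier
      k = suc m · 1#
      0≤k : 0# ≤ k
      0≤k = ·1-nonNeg (suc m)
      0≤gtk : 0# ≤ g * t * k
      0≤gtk = *-nonNeg (*-nonNeg 0≤g 0≤t) 0≤k
      0≤3 : 0# ≤ 1# + 1# + 1#
      0≤3 = +-nonNeg (+-nonNeg 0≤1 0≤1) 0≤1
      0≤slack : 0# ≤ 1# + 1# + 1# + (g * t * k + g * t * k) + g * k + (1# + 1# + 1#) * (g + g)
      0≤slack = +-nonNeg (+-nonNeg (+-nonNeg 0≤3 (+-nonNeg 0≤gtk 0≤gtk)) (*-nonNeg 0≤g 0≤k))
        (*-nonNeg 0≤3 (+-nonNeg 0≤g 0≤g))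

theorem1 : ∀ {ℓ} (R : RealField ℓ) → let open RealField R in let open Exploration R in
    (√3 : Carrier) → 0# ≤ √3 → √3 * √3 ≈ 1# + 1# + 1# →
    (tie : TieBreak) →
    IsCompetitiveRatio (heavyTest √3 tie) ((√3 + 1#) * (1# + 1#) ⁻¹)
theorem1 R √3 0≤√3 √3²≈3 tie =
  (λ ρ → LowerBound.competitive⇒≥ R √3 (0≤√3 , √3²≈3) tie 2ρ≈) ,
  -- The ratio is itself competitive, so every lower bound `l` lies below it.
  λ l l-lower → l-lower _ λ Γ s →
    let (o , isOpt , o≈) = CycleWalks.optimum R Γ s in
    o , isOpt , UpperBound.heavyTest≤ R √3 (0≤√3 , √3²≈3) tie Γ s 2ρ≈ o≈
  where
  2ρ≈ = OrderedField.half+half R _
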